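{- Let $d\ge 1$ and let $\mathbf{s}=(s_1,\ldots,s_d)$ be a sequence of positive integers such that $s_1=\cdots=s_i$ for some $1\le i\le d$, and $s_j<s_{j+1}$ for all $i\le j\le d-1$. Let $k\in\mathbb{Z}_{>0}$. Then $\mathbf{P}_d^{(\mathbf{s})}$ is Gorenstein of index $k$ if and only if there exists a sequence $\mathbf{t}=(t_1,\ldots,t_d)$ such that $t_j=ks_j$ for all $1\le j\le d$ (which implies that $t_1=\cdots=t_i$ and $t_j<t_{j+1}$ for $i\le j\le d-1$) and $\mathbf{P}_d^{(\mathbf{t})}$ is reflexive up to translation.
   Context: For a sequence of positive integers $\mathbf{s}=(s_1,\ldots,s_d)$, the $\mathbf{s}$-lecture hall polytope is $\mathbf{P}_d^{(\mathbf{s})}=\{\mathbf{x}\in\mathbb{R}^d : 0\le \frac{x_1}{s_1}\le\frac{x_2}{s_2}\le\cdots\le\frac{x_d}{s_d}\le 1\}$, a $d$-dimensional lattice polytope. A $d$-dimensional lattice polytope $\mathcal{P}\subset\mathbb{R}^d$ is Fano if $(\mathcal{P}\setminus\partial\mathcal{P})\cap\mathbb{Z}^d=\{\mathbf{0}\}$. It is reflexive if it is Fano and its dual polytope $\mathcal{P}^\vee=\{y\in\mathbb{R}^d : \langle x,y\rangle\le 1 \text{ for all } x\in\mathcal{P}\}$ is a lattice polytope. "Reflexive up to translation" means that some translate by a vector in $\mathbb{Z}^d$ is reflexive. Two $d$-dimensional lattice polytopes $\mathcal{P},\mathcal{Q}\subset\mathbb{R}^d$ are unimodularly equivalent if $\mathcal{Q}=f_U(\mathcal{P})+\mathbf{w}$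 for some $U\in\mathbb{Z}^{d\times d}$ with $\det U=\pm1$ and some $\mathbf{w}\in\mathbb{Z}^d$, where $f_U(\mathbf{v})=\mathbf{v}U$. For $c\in\mathbb{Z}_{>0}$, $\mathcal{P}$ is Gorenstein of index $c$ if $c\mathcal{P}=\{c\alpha:\alpha\in\mathcal{P}\}$ is unimodularly equivalent to a reflexive polytope. -}

module Defs where

open import Algebra.Apartness.Bundles using (HeytingField)
open import Algebra.Bundles using (CommutativeRing)
import Algebra.Definitions.RawMonoid as RawMonoidOps
import Algebra.Properties.Ring as RingProperties
open import Data.Empty using (⊥-elim)
open import Data.Fin using (Fin; zero; suc; toℕ; punchIn)
open import Data.Integer as ℤ using (ℤ; +_; -[1+_])
import Data.Integer.Properties as ℤ
open import Data.Nat as ℕ using (ℕ; zero; suc)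
open import Data.Product using (∃; ∃-syntax; _×_; _,_; proj₁)
open import Data.Sum using (_⊎_; inj₁; inj₂)
open import Data.Vec.Functional using (Vector)
open import Level using (Level; _⊔_) renaming (suc to lsuc)
open import Relation.Binary using (Rel; IsStrictPartialOrder)
open import Relation.Binary.PropositionalEquality using (_≡_)
open import Relation.Nullary using (¬_)
open import Relation.Unary using (Pred; _∈_; _≐_)

-- The field of real numbers, given by axioms: a Cauchy-complete Archimedean
-- ordered field.  Classically these axioms determine ℝ up to unique
-- isomorphism.  They are phrased with a strict order and an apartness relation
-- (neither order nor equality is assumed decidable), so that they also hold for
-- the Cauchy reals constructively.
record RealField c ℓ₁ ℓ₂ : Set (lsuc (c ⊔ ℓ₁ ⊔ ℓ₂)) where
  field
    heytingField : HeytingField c ℓ₁ ℓ₂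

  open HeytingField heytingField public

  commutativeRing : CommutativeRing c ℓ₁
  commutativeRing = record { isCommutativeRing = isCommutativeRing }

  open CommutativeRing commutativeRing public
    using (ring; +-rawMonoid)

  fromℕ : ℕ → Carrier
  fromℕ n = RawMonoidOps._×_ +-rawMonoid n 1#

  infix 4 _<_
  field
    _<_                  : Rel Carrier ℓ₂
    isStrictPartialOrder : IsStrictPartialOrder _≈_ _<_
    #⇒<⊎>                : ∀ {x y} → x # y → (x < y) ⊎ (y < x)
    <⇒#                  : ∀ {x y} → x < y → x # y
    +-monoʳ-<            : ∀ z {x y} → x < y → z + x < z + y
    *-pos                : ∀ {x y} → 0# < x → 0# < y → 0# < x * y
    archimedean          : ∀ x → ∃[ n ] x < fromℕ n
    complete             : (f : ℕ → Carrier) →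
      (∀ ε → 0# < ε → ∃[ N ] ∀ m n → N ℕ.≤ m → N ℕ.≤ n → f m < f n + ε) →
      ∃[ l ] ∀ ε → 0# < ε → ∃[ N ] ∀ n → N ℕ.≤ n → (f n < l + ε) × (l < f n + ε)

  infix 4 _≤_
  _≤_ : Rel Carrier ℓ₂
  x ≤ y = ¬ (y < x)

  fromℤ : ℤ → Carrier
  fromℤ (+ n)    = fromℕ n
  fromℤ -[1+ n ] = - fromℕ (suc n)

  private
    module < = IsStrictPartialOrder isStrictPartialOrder
    open RingProperties ring using (-‿involutive; -‿distribˡ-*)

    1#0 : 1# # 0#
    1#0 = invertible⇒# (1# , trans (*-identityˡ _) 1-0≈1 , trans (*-identityʳ _) 1-0≈1)
      where
      -0≈0 : - 0# ≈ 0#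
      -0≈0 = trans (sym (+-identityˡ _)) (-‿inverseʳ 0#)
      1-0≈1 : 1# - 0# ≈ 1#
      1-0≈1 = trans (+-congˡ -0≈0) (+-identityʳ 1#)

    0<1 : 0# < 1#
    0<1 with #⇒<⊎> 1#0
    ... | inj₂ 0<1 = 0<1
    ... | inj₁ 1<0 = <.<-respʳ-≈ [-1]²≈1 (*-pos 0<-1 0<-1)
      where
      0<-1 : 0# < - 1#
      0<-1 = <.<-respˡ-≈ (-‿inverseˡ 1#)
        (<.<-respʳ-≈ (+-identityʳ _) (+-monoʳ-< (- 1#) 1<0))
      [-1]²≈1 : - 1# * - 1# ≈ 1#
      [-1]²≈1 = trans (sym (-‿distribˡ-* 1# (- 1#)))
        (trans (-‿cong (*-identityˡ _)) (-‿involutive 1#))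

    0<fromℕ : ∀ n → 0# < fromℕ (suc n)
    0<fromℕ zero    = <.<-respʳ-≈ (sym (+-identityʳ 1#)) 0<1
    0<fromℕ (suc n) = <.trans 0<1
      (<.<-respˡ-≈ (+-identityʳ 1#) (+-monoʳ-< 1# (0<fromℕ n)))

  fromℕ#0 : ∀ {n} → 0 ℕ.< n → fromℕ n # 0#
  fromℕ#0 {suc n} _ = #-sym (<⇒# (0<fromℕ n))

  -- #⇒invertible supplies an inverse of fromℕ n - 0#.
  1/ : (n : ℕ) → 0 ℕ.< n → Carrier
  1/ n n>0 = proj₁ (#⇒invertible (fromℕ#0 n>0))

Matrix : ℕ → Set
Matrix d = Fin d → Fin d → ℤ

sumℤ : ∀ {n} → Vector ℤ n → ℤ
sumℤ = RawMonoidOps.sum ℤ.+-0-rawMonoid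

-- Laplace expansion along the first row.
det : ∀ {d} → Matrix d → ℤ
det {zero}  U = ℤ.1ℤ
det {suc d} U = sumℤ λ j →
  (ℤ.-1ℤ ℤ.^ toℕ j) ℤ.* U zero j ℤ.* det (λ a b → U (suc a) (punchIn j b))

module Polytopes {c ℓ₁ ℓ₂ : Level} (ℝ : RealField c ℓ₁ ℓ₂) where
  open RealField ℝ

  private
    variable
      d n : ℕ
      p q : Level

  Point : ℕ → Set c
  Point d = Vector Carrier d

  -- Subsets of ℝ^d are arbitrary predicates on Point d; every set constructed
  -- below respects _≈ᵥ_.
  infix 4 _≈ᵥ_
  _≈ᵥ_ : Rel (Point d) ℓ₁
  x ≈ᵥ y = ∀ j → x j ≈ y j

  sum : Vector Carrier n → Carrier
  sum = RawMonoidOps.sum +-rawMonoid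

  ⟨_,_⟩ : Point d → Point d → Carrier
  ⟨ x , y ⟩ = sum λ j → x j * y j

  ι : Vector ℤ d → Point d
  ι z j = fromℤ (z j)

  convexHull : Vector (Point d) n → Pred (Point d) (c ⊔ ℓ₁ ⊔ ℓ₂)
  convexHull v x = ∃[ μ ]
    (∀ i → 0# ≤ μ i) × (sum μ ≈ 1#) × (∀ j → x j ≈ sum λ i → μ i * v i j)

  AffinelyIndependent : Vector (Point d) n → Set (c ⊔ ℓ₁)
  AffinelyIndependent v = ∀ μ → sum μ ≈ 0# →
    (∀ j → sum (λ i → μ i * v i j) ≈ 0#) → ∀ i → μ i ≈ 0#

  IsLatticePolytope : Pred (Point d) p → Set (c ⊔ ℓ₁ ⊔ ℓ₂ ⊔ p)
  IsLatticePolytope {d} P =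
    ∃[ n ] ∃ λ (v : Vector (Vector ℤ d) n) → P ≐ convexHull (λ i → ι (v i))

  IsFullDimensional : Pred (Point d) p → Set (c ⊔ ℓ₁ ⊔ p)
  IsFullDimensional {d} P = ∃ λ (v : Vector (Point d) (suc d)) →
    (∀ i → v i ∈ P) × AffinelyIndependent v

  IsFullLatticePolytope : Pred (Point d) p → Set (c ⊔ ℓ₁ ⊔ ℓ₂ ⊔ p)
  IsFullLatticePolytope P = IsLatticePolytope P × IsFullDimensional P

  -- 𝒫 ∖ ∂𝒫 for the usual topology of ℝ^d, given by open boxes.
  interior : Pred (Point d) p → Pred (Point d) (c ⊔ ℓ₂ ⊔ p)
  interior P x = ∃[ ε ] (0# < ε) ×
    (∀ y → (∀ j → (x j - ε < y j) × (y j < x j + ε)) → y ∈ P)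

  IsFano : Pred (Point d) p → Set (c ⊔ ℓ₁ ⊔ ℓ₂ ⊔ p)
  IsFano {d} P = IsFullLatticePolytope P
    × (ι {d} (λ _ → ℤ.0ℤ) ∈ interior P)
    × (∀ (z : Vector ℤ d) → ι z ∈ interior P → ∀ j → z j ≡ ℤ.0ℤ)

  dual : Pred (Point d) p → Pred (Point d) (c ⊔ ℓ₂ ⊔ p)
  dual P y = ∀ x → x ∈ P → ⟨ x , y ⟩ ≤ 1#

  IsReflexive : Pred (Point d) p → Set (c ⊔ ℓ₁ ⊔ ℓ₂ ⊔ p)
  IsReflexive P = IsFano P × IsLatticePolytope (dual P)

  translate : Vector ℤ d → Pred (Point d) p → Pred (Point d) (c ⊔ ℓ₁ ⊔ p)
  translate w P x = ∃[ α ] (α ∈ P) × (x ≈ᵥ λ j → α j + ι w j)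

  IsReflexiveUpToTranslation : Pred (Point d) p → Set (c ⊔ ℓ₁ ⊔ ℓ₂ ⊔ p)
  IsReflexiveUpToTranslation {d} P =
    ∃ λ (w : Vector ℤ d) → IsReflexive (translate w P)

  dilate : ℕ → Pred (Point d) p → Pred (Point d) (c ⊔ ℓ₁ ⊔ p)
  dilate k P x = ∃[ α ] (α ∈ P) × (x ≈ᵥ λ j → fromℕ k * α j)

  linearMap : Matrix d → Point d → Point d
  linearMap U v j = sum λ i → v i * fromℤ (U i j)

  image : (Point d → Point d) → Pred (Point d) p → Pred (Point d) (c ⊔ ℓ₁ ⊔ p)
  image f P x = ∃[ α ] (α ∈ P) × (x ≈ᵥ f α)

  UnimodularlyEquivalent : Pred (Point d) p → Pred (Point d) q →
                           Set (c ⊔ ℓ₁ ⊔ ℓ₂ ⊔ p ⊔ q)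
  UnimodularlyEquivalent {d} P Q =
    IsFullLatticePolytope P × IsFullLatticePolytope Q ×
    ∃ λ (U : Matrix d) → ((det U ≡ ℤ.1ℤ) ⊎ (det U ≡ ℤ.-1ℤ)) ×
    ∃ λ (w : Vector ℤ d) → Q ≐ translate w (image (linearMap U) P)

  -- The reflexive polytope is taken at the universe level of convexHull, which
  -- accommodates every polytope.
  IsGorenstein : ℕ → Pred (Point d) p → Set (lsuc (c ⊔ ℓ₁ ⊔ ℓ₂) ⊔ p)
  IsGorenstein {d} k P = (0 ℕ.< k) × IsFullLatticePolytope P ×
    ∃ λ (Q : Pred (Point d) (c ⊔ ℓ₁ ⊔ ℓ₂)) →
    IsReflexive Q × UnimodularlyEquivalent (dilate k P) Q

  lectureHall : (s : Fin d → ℕ) → (∀ j → 0 ℕ.< s j) → Pred (Point d) ℓ₂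
  lectureHall {d} s s>0 x =
      (∀ j → toℕ j ≡ 0 → 0# ≤ ratio j)
    × (∀ j j′ → toℕ j′ ≡ suc (toℕ j) → ratio j ≤ ratio j′)
    × (∀ j → suc (toℕ j) ≡ d → ratio j ≤ 1#)
    where
    ratio : Fin d → Carrier
    ratio j = x j * 1/ (s j) (s>0 j)

{-# OPTIONS --safe #-}
module Submission where

-- Since P^(ks) = k P^(s), the two conditions differ only by the affine unimodular map
-- allowed in the definition of Gorenstein.  An integer matrix of determinant ±1 has an
-- integer inverse, so such a map is a bijection of ℝ^d that restricts to ℤ^d; it transports
-- lattice polytopes, full dimension and interior lattice points, and its transposed inverse
-- transports the dual.  Hence reflexivity is invariant under it.  Conversely one needs that
-- P^(s) itself is a full lattice polytope: it is the simplex on the points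
-- (0, …, 0, s_i, …, s_d), with barycentric coordinates the gaps of
-- 0 ≤ x_1/s_1 ≤ ⋯ ≤ x_d/s_d ≤ 1.

open import Defs
open import Algebra.Bundles using (Semiring; CommutativeRing)
import Algebra.Properties.Ring as RingProperties
open import Algebra.Properties.Semiring.Mult using (×1-homo-*; ×-homo-+)
import Algebra.Properties.Semiring.Sum as SemiringSum
import Algebra.Solver.Ring as RingSolver
open import Algebra.Solver.Ring.AlmostCommutativeRing
  using (fromCommutativeRing; _-Raw-AlmostCommutative⟶_)
open import Data.Empty using (⊥-elim)
open import Data.Fin using (Fin; zero; suc; toℕ; punchIn; punchOut)
open import Data.Fin.Properties using (punchIn-punchOut; suc-injective)
open import Data.Integer as ℤ using (ℤ; -[1+_]; 0ℤ; 1ℤ; _⊖_)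
import Data.Integer.Properties as ℤ
open import Data.Integer.Solver using (module +-*-Solver)
open import Data.Maybe using (Maybe; just; nothing)
open import Data.Nat as ℕ using (ℕ; zero; suc; z≤n; s≤s)
import Data.Nat.Properties as ℕ
open import Data.Product using (Σ; ∃; _×_; _,_; proj₁; proj₂)
open import Data.Sum using (_⊎_; inj₁; inj₂)
open import Data.Vec.Functional using (Vector; _∷_; tail)
open import Function using (_∘_; flip)
open import Function.Bundles using (_⇔_; mk⇔; Equivalence)
open import Level using (Level; _⊔_)
open import Relation.Binary using (IsStrictPartialOrder; _Respects_)
open import Relation.Binary.PropositionalEquality as ≡ using (_≡_; _≢_; cong; cong₂)
import Relation.Binary.Reasoning.Setoid as SetoidReasoning
open import Relation.Nullary using (yes; no)
open import Relation.Unary using (Pred; _∈_; _≐_; _⊆_)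
open import Relation.Unary.Properties using (≐-sym; ≐-trans)

-- Being reflexive fixes the position of the origin, and dualizing is not compatible with
-- translations, so only the linear part of a unimodular map can be transported. The translation is
-- absorbed instead: if `Q = (kP)U + w` and `V` is the inverse of `U`, then `QV = kP + wV`, and `wV`
-- is again a lattice vector. This is why the Gorenstein side matches reflexivity up to translation.
--
-- Two obstacles shape the rest. Unimodularity is stated through the expansion of the determinant
-- along the first row, so the integer inverse has to be extracted from that recursion: the adjugate
-- needs alternation in the rows and yields a right inverse, and invariance under transposition
-- turns this into a two-sided one. Moreover, neither order nor equality of the field is assumed
-- decidable, and sets are predicates on a setoid. Hence inequalities are proved as negations, and
-- compatibility with pointwise equality is carried along explicitly. Interiors are defined by
-- boxes, which a linear map does not preserve, so their transport needs a quantitative continuity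
-- bound.

-- Matrix and vector sums over a semiring, used for both the integers and the field.

module MatrixAction {c ℓ} (R : Semiring c ℓ) where
  open Semiring R renaming (_+_ to _⊞_; _*_ to _⊠_) hiding (zero)
  open SemiringSum R
    using (sum; sum-cong-≋; ∑-comm; *-distribˡ-sum; *-distribʳ-sum; sum-replicate-zero)
  open SetoidReasoning setoid

  -- Interchange of two finite sums. It is the common source of composition of linear maps, of the
  -- adjunction between a matrix and its transpose, and, with `A` read as a family of points, of
  -- linearity on convex combinations.
  mul-assoc : ∀ {m n} (v : Vector Carrier m) (A : Fin m → Fin n → Carrier) (w : Vector Carrier n) →
    sum (λ j → sum (λ i → v i ⊠ A i j) ⊠ w j) ≈ sum (λ i → v i ⊠ sum (λ j → A i j ⊠ w j))
  mul-assoc v A w = begin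
    sum (λ j → sum (λ i → v i ⊠ A i j) ⊠ w j)
      ≈⟨ sum-cong-≋ (λ j → *-distribʳ-sum (w j) (λ i → v i ⊠ A i j)) ⟩
    sum (λ j → sum (λ i → v i ⊠ A i j ⊠ w j))
      ≈⟨ ∑-comm (λ j i → v i ⊠ A i j ⊠ w j) ⟩
    sum (λ i → sum (λ j → v i ⊠ A i j ⊠ w j))
      ≈⟨ sum-cong-≋ (λ i → sum-cong-≋ (λ j → *-assoc (v i) (A i j) (w j))) ⟩
    sum (λ i → sum (λ j → v i ⊠ (A i j ⊠ w j)))
      ≈⟨ sum-cong-≋ (λ i → *-distribˡ-sum (v i) (λ j → A i j ⊠ w j)) ⟨
    sum (λ i → v i ⊠ sum (λ j → A i j ⊠ w j)) ∎

  -- Conditions on the entries, so that a product of matrices can satisfy them without a Kronecker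
  -- delta or function extensionality.
  Identity : ∀ {n} → (Fin n → Fin n → Carrier) → Set ℓ
  Identity I = (∀ i → I i i ≈ 1#) × (∀ i j → i ≢ j → I i j ≈ 0#)

  sum-zero : ∀ {n} (f : Vector Carrier n) → (∀ i → f i ≈ 0#) → sum f ≈ 0#
  sum-zero {n} f f≈0 = trans (sum-cong-≋ f≈0) (sum-replicate-zero n)

  sum-single : ∀ {n} (f : Vector Carrier n) k → (∀ i → i ≢ k → f i ≈ 0#) → sum f ≈ f k
  sum-single f zero f≈0 =
    trans (+-congˡ (sum-zero (tail f) (λ i → f≈0 (suc i) λ ()))) (+-identityʳ _)
  sum-single f (suc k) f≈0 = trans (+-cong (f≈0 zero λ ())
    (sum-single (tail f) k (λ i i≢k → f≈0 (suc i) (i≢k ∘ suc-injective)))) (+-identityˡ _)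

  mul-identityʳ : ∀ {n} {I : Fin n → Fin n → Carrier} → Identity I →
    ∀ (v : Vector Carrier n) j → sum (λ i → v i ⊠ I i j) ≈ v j
  mul-identityʳ (diag , off) v j = trans
    (sum-single _ j (λ i i≢j → trans (*-congˡ (off i j i≢j)) (zeroʳ _)))
    (trans (*-congˡ (diag j)) (*-identityʳ _))

  mul-identityˡ : ∀ {n} {I : Fin n → Fin n → Carrier} → Identity I →
    ∀ (v : Vector Carrier n) i → sum (λ j → I i j ⊠ v j) ≈ v i
  mul-identityˡ (diag , off) v i = trans
    (sum-single _ i (λ j j≢i → trans (*-congʳ (off i j (j≢i ∘ ≡.sym))) (zeroˡ _)))
    (trans (*-congʳ (diag i)) (*-identityˡ _))

module ℤMatrix = MatrixAction ℤ.+-*-semiring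

-- Determinants of integer matrices and the inverse of a unimodular matrix.

module Determinant where
  private module ℤSum = SemiringSum ℤ.+-*-semiring
  open ℤMatrix
  open import Data.Integer using (-1ℤ; _+_; _*_; -_; _^_)
  open ≡ using (refl)

  private
    variable
      d m n : ℕ

  minor : Matrix (suc d) → Fin (suc d) → Fin (suc d) → Matrix d
  minor U i j a b = U (punchIn i a) (punchIn j b)

  -- Opaque copies of sumℤ and det, whose arguments can be inferred by unification.
  opaque
    ∑ : Vector ℤ n → ℤ
    ∑ = sumℤ

    Δ : Matrix d → ℤ
    Δ = det

    sgn : Fin n → ℤ
    sgn i = -1ℤ ^ toℕ i

    sgn-zero : sgn {suc n} zero ≡ 1ℤ
    sgn-zero = refl

    sgn-suc : (i : Fin n) → sgn (suc i) ≡ - sgn i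
    sgn-suc i = ℤ.-1*i≡-i (sgn i)

    Δ-empty : (U : Matrix 0) → Δ U ≡ 1ℤ
    Δ-empty U = refl

    Δ-row : (U : Matrix (suc d)) → Δ U ≡ ∑ λ j → sgn j * U zero j * Δ (minor U zero j)
    Δ-row U = refl

    ∑-suc : {f : Vector ℤ (suc n)} → ∑ f ≡ f zero + ∑ (tail f)
    ∑-suc = refl

    ∑-cong : {f g : Vector ℤ n} → (∀ i → f i ≡ g i) → ∑ f ≡ ∑ g
    ∑-cong = ℤSum.sum-cong-≗

    ∑-comm : (f : Fin m → Fin n → ℤ) → (∑ λ i → ∑ λ j → f i j) ≡ (∑ λ j → ∑ λ i → f i j)
    ∑-comm = ℤSum.∑-comm

    *-∑ : ∀ x {f : Vector ℤ n} → x * ∑ f ≡ ∑ λ i → x * f i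
    *-∑ x {f} = ℤSum.*-distribˡ-sum x f

  -∑ : {f : Vector ℤ n} → - ∑ f ≡ ∑ λ i → - f i
  -∑ {f = f} = ≡.trans (≡.sym (ℤ.-1*i≡-i (∑ f)))
    (≡.trans (*-∑ -1ℤ) (∑-cong λ i → ℤ.-1*i≡-i (f i)))

  sgn² : (i : Fin n) → sgn i * sgn i ≡ 1ℤ
  sgn² zero = cong₂ _*_ sgn-zero sgn-zero
  sgn² (suc i) = begin
    sgn (suc i) * sgn (suc i)   ≡⟨ cong₂ _*_ (sgn-suc i) (sgn-suc i) ⟩
    - sgn i * - sgn i           ≡⟨ solve 1 (λ x → (:- x) :* (:- x) := x :* x) refl (sgn i) ⟩
    sgn i * sgn i               ≡⟨ sgn² i ⟩
    1ℤ ∎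
    where
    open ≡.≡-Reasoning
    open +-*-Solver

  Δ-cong : {U W : Matrix d} → (∀ a b → U a b ≡ W a b) → Δ U ≡ Δ W
  Δ-cong {zero}  {U} {W} U≗W = ≡.trans (Δ-empty U) (≡.sym (Δ-empty W))
  Δ-cong {suc d} {U} {W} U≗W = begin
    Δ U                                              ≡⟨ Δ-row U ⟩
    (∑ λ j → sgn j * U zero j * Δ (minor U zero j))  ≡⟨ ∑-cong (λ j → cong₂ (λ u w → sgn j * u * w)
      (U≗W zero j) (Δ-cong λ a b → U≗W (suc a) (punchIn j b))) ⟩
    (∑ λ j → sgn j * W zero j * Δ (minor W zero j))  ≡⟨ Δ-row W ⟨
    Δ W ∎
    where open ≡.≡-Reasoning

  -- Expanding the minors of either expansion along the other line gives the same double
  -- sum, over the minors that miss the first row, the first column and one more of each.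
  Δ-column : (U : Matrix (suc d)) → Δ U ≡ ∑ λ i → sgn i * U i zero * Δ (minor U i zero)
  Δ-column {zero}  U = ≡.trans (Δ-row U) (∑-cong λ { zero → refl })
  Δ-column {suc d} U = begin
    Δ U
      ≡⟨ Δ-row U ⟩
    (∑ λ j → sgn j * U zero j * Δ (minor U zero j))
      ≡⟨ ∑-suc ⟩
    corner + (∑ λ j → sgn (suc j) * U zero (suc j) * Δ (minor U zero (suc j)))
      ≡⟨ cong (corner +_) (∑-cong λ j →
           ≡.trans (cong (sgn (suc j) * U zero (suc j) *_) (Δ-column (minor U zero (suc j))))
                   (*-∑ (sgn (suc j) * U zero (suc j)))) ⟩
    corner + (∑ λ j → ∑ λ i → sgn (suc j) * U zero (suc j) * (sgn i * U (suc i) zero * D i j))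
      ≡⟨ cong (corner +_) (∑-comm λ j i →
           sgn (suc j) * U zero (suc j) * (sgn i * U (suc i) zero * D i j)) ⟩
    corner + (∑ λ i → ∑ λ j → sgn (suc j) * U zero (suc j) * (sgn i * U (suc i) zero * D i j))
      ≡⟨ cong (corner +_) (∑-cong λ i → ≡.trans
           (∑-cong λ j → rearrange (sgn-suc i) (sgn-suc j) (U (suc i) zero) (U zero (suc j)) (D i j))
           (≡.sym (*-∑ (sgn (suc i) * U (suc i) zero)))) ⟩
    corner + (∑ λ i → sgn (suc i) * U (suc i) zero * (∑ λ j → sgn j * U zero (suc j) * D i j))
      ≡⟨ cong (corner +_) (∑-cong λ i →
           cong (sgn (suc i) * U (suc i) zero *_) (≡.sym (Δ-row (minor U (suc i) zero)))) ⟩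
    corner + (∑ λ i → sgn (suc i) * U (suc i) zero * Δ (minor U (suc i) zero))
      ≡⟨ ∑-suc ⟨
    (∑ λ i → sgn i * U i zero * Δ (minor U i zero)) ∎
    where
    open ≡.≡-Reasoning
    corner : ℤ
    corner = sgn (zero {suc d}) * U zero zero * Δ (minor U zero zero)
    D : Fin (suc d) → Fin (suc d) → ℤ
    D i j = Δ (λ a b → U (suc (punchIn i a)) (suc (punchIn j b)))
    rearrange : ∀ {s s′ t t′} → s′ ≡ - s → t′ ≡ - t → ∀ x y z →
      t′ * y * (s * x * z) ≡ s′ * x * (t * y * z)
    rearrange {s} {t = t} refl refl x y z = solve 5 (λ s t x y z →
      (:- t) :* y :* (s :* x :* z) := (:- s) :* x :* (t :* y :* z)) refl s t x y z
      where open +-*-Solver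

  -- The row expansion of the transpose is the column expansion of `U`, with transposed minors
  -- handled by induction.
  Δ-transpose : (U : Matrix d) → Δ (flip U) ≡ Δ U
  Δ-transpose {zero}  U = ≡.trans (Δ-empty (flip U)) (≡.sym (Δ-empty U))
  Δ-transpose {suc d} U = begin
    Δ (flip U)                                              ≡⟨ Δ-row (flip U) ⟩
    (∑ λ i → sgn i * U i zero * Δ (flip (minor U i zero)))  ≡⟨ ∑-cong (λ i →
      cong (sgn i * U i zero *_) (Δ-transpose (minor U i zero))) ⟩
    (∑ λ i → sgn i * U i zero * Δ (minor U i zero))         ≡⟨ Δ-column U ⟨
    Δ U ∎
    where open ≡.≡-Reasoning

  -- Expand down the first column. The terms of the two top rows trade places with opposite signs;
  -- every other term has a minor that still contains both rows, so induction on the size applies.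
  Δ-swap : (r r′ : Vector ℤ (suc (suc d))) (W : Vector (Vector ℤ (suc (suc d))) d) →
    Δ (r′ ∷ r ∷ W) ≡ - Δ (r ∷ r′ ∷ W)
  Δ-swap {d} r r′ W = begin
    Δ (r′ ∷ r ∷ W)
      ≡⟨ expand r r′ ⟩
    r′ zero * A r + (- (r zero * A r′) + ∑ (S r r′))
      ≡⟨ cong (λ z → r′ zero * A r + (- (r zero * A r′) + z)) (≡.trans
           (∑-cong λ i → ≡.trans (cong (sgn (suc (suc i)) * W i zero *_) (minors r r′ W i))
             (≡.sym (ℤ.neg-distribʳ-* (sgn (suc (suc i)) * W i zero) _)))
           (≡.sym -∑)) ⟩
    r′ zero * A r + (- (r zero * A r′) + - ∑ (S r′ r))
      ≡⟨ solve 3 (λ x y z → x :+ (:- y :+ :- z) := :- (y :+ (:- x :+ z))) refl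
           (r′ zero * A r) (r zero * A r′) (∑ (S r′ r)) ⟩
    - (r zero * A r′ + (- (r′ zero * A r) + ∑ (S r′ r)))
      ≡⟨ cong -_ (expand r′ r) ⟨
    - Δ (r ∷ r′ ∷ W) ∎
    where
    open ≡.≡-Reasoning
    open +-*-Solver
    -- The second copy of `r` only fills the row that the minor deletes.
    A : Vector ℤ (suc (suc d)) → ℤ
    A r = Δ (minor (r ∷ r ∷ W) zero zero)
    S : (r r′ : Vector ℤ (suc (suc d))) → Fin d → ℤ
    S r r′ i = sgn (suc (suc i)) * W i zero * Δ (minor (r′ ∷ r ∷ W) (suc (suc i)) zero)
    term₀ : ∀ {s x y z} → s ≡ 1ℤ → y ≡ z → s * x * y ≡ x * z
    term₀ {x = x} {y} refl refl = cong (_* y) (ℤ.*-identityˡ x)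
    term₁ : ∀ {s t x y z} → s ≡ 1ℤ → t ≡ - s → y ≡ z → t * x * y ≡ - (x * z)
    term₁ {x = x} {y} refl refl refl = solve 2 (λ x y → :- con 1ℤ :* x :* y := :- (x :* y)) refl x y
    expand : ∀ r r′ → Δ (r′ ∷ r ∷ W) ≡ r′ zero * A r + (- (r zero * A r′) + ∑ (S r r′))
    expand r r′ = ≡.trans (Δ-column (r′ ∷ r ∷ W)) (≡.trans ∑-suc (cong₂ _+_
      (term₀ sgn-zero (Δ-cong λ { zero b → refl ; (suc a) b → refl }))
      (≡.trans ∑-suc (cong (_+ ∑ (S r r′))
        (term₁ sgn-zero (sgn-suc zero) (Δ-cong λ { zero b → refl ; (suc a) b → refl }))))))
    minors : ∀ {d} (r r′ : Vector ℤ (suc (suc d))) (W : Vector (Vector ℤ (suc (suc d))) d) i →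
      Δ (minor (r′ ∷ r ∷ W) (suc (suc i)) zero) ≡ - Δ (minor (r ∷ r′ ∷ W) (suc (suc i)) zero)
    minors {suc d} r r′ W i = ≡.trans
      (Δ-cong λ { zero b → refl ; (suc zero) b → refl ; (suc (suc a)) b → refl })
      (≡.trans (Δ-swap (tail r) (tail r′) (λ a b → W (punchIn i a) (suc b)))
        (cong -_ (Δ-cong λ { zero b → refl ; (suc zero) b → refl ; (suc (suc a)) b → refl })))

  toFront : Fin (suc d) → Vector (Vector ℤ m) (suc d) → Vector (Vector ℤ m) (suc d)
  toFront i W = W i ∷ λ a → W (punchIn i a)

  -- The row passes the `i` rows above it, each passage costing a sign. The recursion first lifts it
  -- to just below the top row, then swaps these two; lifting below a fixed top row reduces, by
  -- expansion along that row, to matrices one size smaller.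
  Δ-toFront : ∀ i (U : Matrix (suc d)) → Δ (toFront i U) ≡ sgn i * Δ U
  Δ-∷-toFront : ∀ (r : Vector ℤ (suc (suc d))) i W → Δ (r ∷ toFront i W) ≡ sgn i * Δ (r ∷ W)

  Δ-toFront zero U = ≡.trans (Δ-cong λ { zero b → refl ; (suc a) b → refl })
    (≡.sym (≡.trans (cong (_* Δ U) sgn-zero) (ℤ.*-identityˡ (Δ U))))
  Δ-toFront {suc d} (suc i) U = begin
    Δ (toFront (suc i) U)
      ≡⟨ Δ-cong (λ { zero b → refl ; (suc zero) b → refl ; (suc (suc a)) b → refl }) ⟩
    Δ (U (suc i) ∷ U zero ∷ λ a → U (suc (punchIn i a)))
      ≡⟨ Δ-swap (U zero) (U (suc i)) _ ⟩
    - Δ (U zero ∷ toFront i (tail U))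
      ≡⟨ cong -_ (Δ-∷-toFront (U zero) i (tail U)) ⟩
    - (sgn i * Δ (U zero ∷ tail U))
      ≡⟨ cong (λ z → - (sgn i * z)) (Δ-cong λ { zero b → refl ; (suc a) b → refl }) ⟩
    - (sgn i * Δ U)
      ≡⟨ ℤ.neg-distribˡ-* (sgn i) (Δ U) ⟩
    - sgn i * Δ U
      ≡⟨ cong (_* Δ U) (sgn-suc i) ⟨
    sgn (suc i) * Δ U ∎
    where open ≡.≡-Reasoning

  Δ-∷-toFront r i W = begin
    Δ (r ∷ toFront i W)
      ≡⟨ Δ-row (r ∷ toFront i W) ⟩
    (∑ λ j → sgn j * r j * Δ (minor (r ∷ toFront i W) zero j))
      ≡⟨ ∑-cong (λ j → ≡.trans
           (cong (sgn j * r j *_) (≡.trans (Δ-cong λ { zero b → refl ; (suc a) b → refl })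
             (Δ-toFront i (λ a b → W a (punchIn j b)))))
           (solve 3 (λ x s y → x :* (s :* y) := s :* (x :* y)) refl (sgn j * r j) (sgn i) _)) ⟩
    (∑ λ j → sgn i * (sgn j * r j * Δ (minor (r ∷ W) zero j)))
      ≡⟨ *-∑ (sgn i) ⟨
    sgn i * (∑ λ j → sgn j * r j * Δ (minor (r ∷ W) zero j))
      ≡⟨ cong (sgn i *_) (Δ-row (r ∷ W)) ⟨
    sgn i * Δ (r ∷ W) ∎
    where
    open ≡.≡-Reasoning
    open +-*-Solver

  i≡-i⇒i≡0 : ∀ {i} → i ≡ - i → i ≡ 0ℤ
  i≡-i⇒i≡0 {ℤ.+ zero}   _ = refl
  i≡-i⇒i≡0 {ℤ.+ suc n} ()
  i≡-i⇒i≡0 { -[1+ n ]} ()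

  -- Up to sign the equal row may be moved next to `r`; swapping the two then shows that the
  -- determinant is its own negative, and the integers have no 2-torsion.
  Δ-repeated-row : ∀ (r : Vector ℤ (suc d)) W i → (∀ b → r b ≡ W i b) → Δ (r ∷ W) ≡ 0ℤ
  Δ-repeated-row {suc d} r W i r≗Wi = begin
    Δ (r ∷ W)                          ≡⟨ ℤ.*-identityˡ (Δ (r ∷ W)) ⟨
    1ℤ * Δ (r ∷ W)                     ≡⟨ cong (_* Δ (r ∷ W)) (sgn² i) ⟨
    sgn i * sgn i * Δ (r ∷ W)          ≡⟨ ℤ.*-assoc (sgn i) (sgn i) (Δ (r ∷ W)) ⟩
    sgn i * (sgn i * Δ (r ∷ W))        ≡⟨ cong (sgn i *_) (Δ-∷-toFront r i W) ⟨
    sgn i * Δ (r ∷ toFront i W)        ≡⟨ cong (sgn i *_) (Δ-cong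
      λ { zero b → refl ; (suc zero) b → ≡.sym (r≗Wi b) ; (suc (suc a)) b → refl }) ⟩
    sgn i * Δ (r ∷ r ∷ W′)             ≡⟨ cong (sgn i *_) (i≡-i⇒i≡0 (Δ-swap r r W′)) ⟩
    sgn i * 0ℤ                         ≡⟨ ℤ.*-zeroʳ (sgn i) ⟩
    0ℤ ∎
    where
    open ≡.≡-Reasoning
    W′ : Vector (Vector ℤ (suc (suc d))) d
    W′ a = W (punchIn i a)

  infixl 7 _⊗_
  _⊗_ : Matrix d → Matrix d → Matrix d
  (A ⊗ B) i k = ∑ λ j → A i j * B j k

  adjugate : Matrix d → Matrix d
  adjugate {suc d} U j i = sgn i * (sgn j * Δ (minor U i j))

  -- Row `k` paired with the cofactors of row `i` is the first-row expansion of the matrix with row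
  -- `k` on top of the rows other than `i`. For `k = i` this is `U` with a row moved to the front;
  -- otherwise row `k` occurs twice.
  ⊗-adjugate : ∀ (U : Matrix (suc d)) k i →
    (U ⊗ adjugate U) k i ≡ sgn i * Δ (U k ∷ λ a → U (punchIn i a))
  ⊗-adjugate U k i = begin
    (∑ λ j → U k j * (sgn i * (sgn j * Δ (minor U i j))))
      ≡⟨ ∑-cong (λ j → solve 4 (λ u s t x → u :* (s :* (t :* x)) := s :* (t :* u :* x)) refl
           (U k j) (sgn i) (sgn j) (Δ (minor U i j))) ⟩
    (∑ λ j → sgn i * (sgn j * U k j * Δ (minor U i j)))
      ≡⟨ *-∑ (sgn i) ⟨
    sgn i * (∑ λ j → sgn j * U k j * Δ (minor U i j))
      ≡⟨ cong (sgn i *_) (Δ-row (U k ∷ λ a → U (punchIn i a))) ⟨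
    sgn i * Δ (U k ∷ λ a → U (punchIn i a)) ∎
    where
    open ≡.≡-Reasoning
    open +-*-Solver

  ⊗-adjugate-diagonal : ∀ (U : Matrix d) i → (U ⊗ adjugate U) i i ≡ Δ U
  ⊗-adjugate-diagonal {suc d} U i = begin
    (U ⊗ adjugate U) i i      ≡⟨ ⊗-adjugate U i i ⟩
    sgn i * Δ (toFront i U)   ≡⟨ cong (sgn i *_) (Δ-toFront i U) ⟩
    sgn i * (sgn i * Δ U)     ≡⟨ ℤ.*-assoc (sgn i) (sgn i) (Δ U) ⟨
    sgn i * sgn i * Δ U       ≡⟨ cong (_* Δ U) (sgn² i) ⟩
    1ℤ * Δ U                  ≡⟨ ℤ.*-identityˡ (Δ U) ⟩
    Δ U ∎
    where open ≡.≡-Reasoning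

  ⊗-adjugate-off-diagonal : ∀ (U : Matrix d) k i → k ≢ i → (U ⊗ adjugate U) k i ≡ 0ℤ
  ⊗-adjugate-off-diagonal {suc d} U k i k≢i = ≡.trans (⊗-adjugate U k i) (≡.trans
    (cong (sgn i *_) (Δ-repeated-row (U k) (λ a → U (punchIn i a)) (punchOut i≢k)
      (λ b → cong (λ l → U l b) (≡.sym (punchIn-punchOut i≢k)))))
    (ℤ.*-zeroʳ (sgn i)))
    where
    i≢k : i ≢ k
    i≢k = k≢i ∘ ≡.sym

  -- The determinant is its own inverse, so multiplying the adjugate by it replaces division and
  -- covers both signs at once.
  rightInverse : (U : Matrix d) → Δ U * Δ U ≡ 1ℤ → ∃ λ V → Identity (U ⊗ V)
  rightInverse {d} U det²≡1 = V ,
    (λ i → ≡.trans (U⊗V i i) (≡.trans (cong (Δ U *_) (⊗-adjugate-diagonal U i)) det²≡1)) ,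
    (λ k i k≢i → ≡.trans (U⊗V k i) (≡.trans
      (cong (Δ U *_) (⊗-adjugate-off-diagonal U k i k≢i)) (ℤ.*-zeroʳ (Δ U))))
    where
    V : Matrix d
    V j i = Δ U * adjugate U j i
    U⊗V : ∀ k i → (U ⊗ V) k i ≡ Δ U * (U ⊗ adjugate U) k i
    U⊗V k i = ≡.trans
      (∑-cong λ j → solve 3 (λ x y z → x :* (y :* z) := y :* (x :* z)) refl
        (U k j) (Δ U) (adjugate U j i))
      (≡.sym (*-∑ (Δ U)))
      where open +-*-Solver

  -- The same matrix as `_⊗_`, written with the transparent `sumℤ` so that it computes in the
  -- modules on linear maps.
  product : Matrix d → Matrix d → Matrix d
  product A B i k = sumℤ λ j → A i j * B j k

  Inverses : Matrix d → Matrix d → Set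
  Inverses U V = Identity (product U V) × Identity (product V U)

  opaque
    unfolding ∑

    leftInverse≡rightInverse : {U V W : Matrix d} → Identity (W ⊗ U) → Identity (U ⊗ V) →
      ∀ i j → V i j ≡ W i j
    leftInverse≡rightInverse {U = U} {V} {W} WU UV i j = begin
      V i j                             ≡⟨ mul-identityˡ WU (λ l → V l j) i ⟨
      (∑ λ l → (W ⊗ U) i l * V l j)     ≡⟨ mul-assoc (W i) U (λ l → V l j) ⟩
      (∑ λ k → W i k * (U ⊗ V) k j)     ≡⟨ mul-identityʳ UV (W i) j ⟩
      W i j ∎
      where open ≡.≡-Reasoning

    ±1² : ∀ {i} → (i ≡ 1ℤ) ⊎ (i ≡ -1ℤ) → i * i ≡ 1ℤ
    ±1² (inj₁ eq) = cong₂ _*_ eq eq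
    ±1² (inj₂ eq) = cong₂ _*_ eq eq

    -- A right inverse of the transpose gives a left inverse.
    unimodular⇒inverse : (U : Matrix d) → (det U ≡ 1ℤ) ⊎ (det U ≡ -1ℤ) → ∃ λ V → Inverses U V
    unimodular⇒inverse {d} U detU≡±1
      with V , UV ← rightInverse U (±1² detU≡±1)
         | Wᵀ , (diag , off) ← rightInverse (flip U) (≡.trans
             (cong₂ _*_ (Δ-transpose U) (Δ-transpose U)) (±1² detU≡±1))
      = V , UV , (λ i → ≡.trans (V⊗U UV i i) (proj₁ WU i)) ,
        λ i j i≢j → ≡.trans (V⊗U UV i j) (proj₂ WU i j i≢j)
      where
      W : Matrix d
      W = flip Wᵀ
      W⊗U : ∀ i j → (W ⊗ U) i j ≡ (flip U ⊗ Wᵀ) j i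
      W⊗U i j = ∑-cong λ k → ℤ.*-comm (W i k) (U k j)
      WU : Identity (W ⊗ U)
      WU = (λ i → ≡.trans (W⊗U i i) (diag i)) ,
           (λ i j i≢j → ≡.trans (W⊗U i j) (off j i (i≢j ∘ ≡.sym)))
      V⊗U : Identity (U ⊗ V) → ∀ i j → (V ⊗ U) i j ≡ (W ⊗ U) i j
      V⊗U UV i j = ∑-cong λ k → cong (_* U k j) (leftInverse≡rightInverse {U = U} {V} {W} WU UV i k)

    product-transpose : (A B : Matrix d) → ∀ i k → product (flip B) (flip A) i k ≡ product A B k i
    product-transpose A B i k = ∑-cong λ j → ℤ.*-comm (B j i) (A k j)

    det-identity : (I : Matrix d) → Identity I → det I ≡ 1ℤ
    det-identity {zero}  I I-id = refl
    det-identity {suc d} I (diag , off) = begin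
      det I
        ≡⟨⟩
      (∑ λ j → sgn j * I zero j * Δ (minor I zero j))
        ≡⟨ sum-single (λ j → sgn j * I zero j * Δ (minor I zero j)) zero
             (λ j j≢0 → cong (_* Δ (minor I zero j)) (≡.trans
               (cong (sgn j *_) (off zero j (j≢0 ∘ ≡.sym))) (ℤ.*-zeroʳ (sgn j)))) ⟩
      1ℤ * I zero zero * Δ (minor I zero zero)
        ≡⟨ cong₂ (λ x y → 1ℤ * x * y) (diag zero) (det-identity (minor I zero zero)
             ((λ i → diag (suc i)) , λ i j i≢j → off (suc i) (suc j) (i≢j ∘ suc-injective))) ⟩
      1ℤ ∎
      where open ≡.≡-Reasoning

  inverses-transpose : {U V : Matrix d} → Inverses U V → Inverses (flip U) (flip V)
  inverses-transpose {U = U} {V} (UV , VU) = transpose V U VU , transpose U V UV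
    where
    transpose : ∀ A B → Identity (product A B) → Identity (product (flip B) (flip A))
    transpose A B (diag , off) =
      (λ i → ≡.trans (product-transpose A B i i) (diag i)) ,
      (λ i j i≢j → ≡.trans (product-transpose A B i j) (off j i (i≢j ∘ ≡.sym)))

  -- Defined by recursion on both indices. It is the unimodular matrix of the converse direction,
  -- and its rows are the barycentric coordinates of the generators of a convex hull.
  identityMatrix : Matrix d
  identityMatrix zero    zero    = 1ℤ
  identityMatrix zero    (suc j) = 0ℤ
  identityMatrix (suc i) zero    = 0ℤ
  identityMatrix (suc i) (suc j) = identityMatrix i j

  identityMatrix-identity : Identity (identityMatrix {d})
  identityMatrix-identity = diag , off
    where
    diag : ∀ {d} (i : Fin d) → identityMatrix i i ≡ 1ℤ
    diag zero    = refl
    diag (suc i) = diag i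
    off : ∀ {d} (i j : Fin d) → i ≢ j → identityMatrix i j ≡ 0ℤ
    off zero    zero    0≢0 = ⊥-elim (0≢0 refl)
    off zero    (suc j) _   = refl
    off (suc i) zero    _   = refl
    off (suc i) (suc j) i≢j = off i j (i≢j ∘ cong suc)

-- Arithmetic of the ordered field without a decidable order.

module OrderedField {c ℓ₁ ℓ₂} (ℝ : RealField c ℓ₁ ℓ₂) where
  open RealField ℝ hiding (zero)
  open CommutativeRing commutativeRing using (semiring)
  open RingProperties ring using (-0#≈0#; -‿involutive; -‿+-comm; -‿distribˡ-*; -‿distribʳ-*)
  open SetoidReasoning setoid
  private module < = IsStrictPartialOrder isStrictPartialOrder

  fromℤ-neg : ∀ i → fromℤ (ℤ.- i) ≈ - fromℤ i
  fromℤ-neg (ℤ.+ zero)  = sym -0#≈0#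
  fromℤ-neg (ℤ.+ suc n) = refl
  fromℤ-neg -[1+ n ]    = sym (-‿involutive _)

  fromℤ-⊖ : ∀ m n → fromℤ (m ⊖ n) ≈ fromℕ m - fromℕ n
  fromℤ-⊖ m zero = sym (trans (+-congˡ -0#≈0#) (+-identityʳ _))
  fromℤ-⊖ zero (suc n) = sym (+-identityˡ _)
  fromℤ-⊖ (suc m) (suc n) = begin
    fromℤ (suc m ⊖ suc n)                     ≡⟨ cong fromℤ (ℤ.[1+m]⊖[1+n]≡m⊖n m n) ⟩
    fromℤ (m ⊖ n)                             ≈⟨ fromℤ-⊖ m n ⟩
    fromℕ m - fromℕ n                         ≈⟨ +-identityˡ _ ⟨
    0# + (fromℕ m - fromℕ n)                  ≈⟨ +-congʳ (-‿inverseʳ 1#) ⟨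
    1# - 1# + (fromℕ m - fromℕ n)             ≈⟨ +-assoc _ _ _ ⟩
    1# + (- 1# + (fromℕ m - fromℕ n))         ≈⟨ +-congˡ (+-assoc _ _ _) ⟨
    1# + (- 1# + fromℕ m - fromℕ n)           ≈⟨ +-congˡ (+-congʳ (+-comm _ _)) ⟩
    1# + (fromℕ m - 1# - fromℕ n)             ≈⟨ +-congˡ (+-assoc _ _ _) ⟩
    1# + (fromℕ m + (- 1# - fromℕ n))         ≈⟨ +-assoc _ _ _ ⟨
    fromℕ (suc m) + (- 1# - fromℕ n)          ≈⟨ +-congˡ (-‿+-comm _ _) ⟩
    fromℕ (suc m) - fromℕ (suc n) ∎

  fromℤ-+ : ∀ i j → fromℤ (i ℤ.+ j) ≈ fromℤ i + fromℤ j
  fromℤ-+ (ℤ.+ m)  (ℤ.+ n)  = ×-homo-+ semiring 1# m n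
  fromℤ-+ (ℤ.+ m)  -[1+ n ] = fromℤ-⊖ m (suc n)
  fromℤ-+ -[1+ m ] (ℤ.+ n)  = trans (fromℤ-⊖ n (suc m)) (+-comm _ _)
  fromℤ-+ -[1+ m ] -[1+ n ] = trans
    (-‿cong (trans (reflexive (cong (fromℕ ∘ suc) (≡.sym (ℕ.+-suc m n))))
                   (×-homo-+ semiring 1# (suc m) (suc n))))
    (sym (-‿+-comm _ _))

  fromℕ-* : ∀ m n → fromℕ (m ℕ.* n) ≈ fromℕ m * fromℕ n
  fromℕ-* = ×1-homo-* semiring

  fromℤ-*-pos : ∀ m j → fromℤ (ℤ.+ m ℤ.* j) ≈ fromℕ m * fromℤ j
  fromℤ-*-pos m (ℤ.+ n) = trans (reflexive (cong fromℤ (≡.sym (ℤ.pos-* m n)))) (fromℕ-* m n)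
  fromℤ-*-pos m -[1+ n ] = begin
    fromℤ (ℤ.+ m ℤ.* -[1+ n ])            ≡⟨ cong fromℤ (ℤ.neg-distribʳ-* (ℤ.+ m) (ℤ.+ suc n)) ⟨
    fromℤ (ℤ.- (ℤ.+ m ℤ.* ℤ.+ suc n))     ≈⟨ fromℤ-neg (ℤ.+ m ℤ.* ℤ.+ suc n) ⟩
    - fromℤ (ℤ.+ m ℤ.* ℤ.+ suc n)         ≈⟨ -‿cong (fromℤ-*-pos m (ℤ.+ suc n)) ⟩
    - (fromℕ m * fromℕ (suc n))           ≈⟨ -‿distribʳ-* _ _ ⟩
    fromℕ m * fromℤ -[1+ n ] ∎

  fromℤ-* : ∀ i j → fromℤ (i ℤ.* j) ≈ fromℤ i * fromℤ j
  fromℤ-* (ℤ.+ m)  j = fromℤ-*-pos m j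
  fromℤ-* -[1+ m ] j = begin
    fromℤ (-[1+ m ] ℤ.* j)                ≡⟨ cong fromℤ (ℤ.neg-distribˡ-* (ℤ.+ suc m) j) ⟨
    fromℤ (ℤ.- (ℤ.+ suc m ℤ.* j))         ≈⟨ fromℤ-neg (ℤ.+ suc m ℤ.* j) ⟩
    - fromℤ (ℤ.+ suc m ℤ.* j)             ≈⟨ -‿cong (fromℤ-*-pos (suc m) j) ⟩
    - (fromℕ (suc m) * fromℤ j)           ≈⟨ -‿distribˡ-* _ _ ⟩
    fromℤ -[1+ m ] * fromℤ j ∎

  fromℤ-1 : fromℤ 1ℤ ≈ 1#
  fromℤ-1 = +-identityʳ 1#

  -- Supplies the ring solver with integer coefficients, whose equality is decidable.
  fromℤ-homomorphism :
    CommutativeRing.rawRing ℤ.+-*-commutativeRing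
      -Raw-AlmostCommutative⟶ fromCommutativeRing commutativeRing
  fromℤ-homomorphism = record
    { ⟦_⟧ = fromℤ ; +-homo = fromℤ-+ ; *-homo = fromℤ-* ; -‿homo = fromℤ-neg
    ; 0-homo = refl ; 1-homo = fromℤ-1 }

  private
    fromℤ-≟ : ∀ i j → Maybe (fromℤ i ≈ fromℤ j)
    fromℤ-≟ i j with i ℤ.≟ j
    ... | yes i≡j = just (reflexive (cong fromℤ i≡j))
    ... | no  _   = nothing

  open RingSolver (CommutativeRing.rawRing ℤ.+-*-commutativeRing)
    (fromCommutativeRing commutativeRing) fromℤ-homomorphism fromℤ-≟ public
    using (solve; _:=_; _:+_; _:*_; :-_; _:-_; con)

  private
    variable
      x y z u v : Carrier

  <-resp : x ≈ y → u ≈ v → x < u → y < v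
  <-resp x≈y u≈v x<u = <.<-respˡ-≈ x≈y (<.<-respʳ-≈ u≈v x<u)

  ≤-resp : x ≈ y → u ≈ v → x ≤ u → y ≤ v
  ≤-resp x≈y u≈v x≤u v<y = x≤u (<-resp (sym u≈v) (sym x≈y) v<y)

  ≤-reflexive : x ≈ y → x ≤ y
  ≤-reflexive x≈y = <.irrefl (sym x≈y)

  <⇒≤ : x < y → x ≤ y
  <⇒≤ x<y y<x = <.asym x<y y<x

  -- Cotransitivity of apartness read through the order; it takes the place of trichotomy.
  <-compare : x < y → ∀ z → (x < z) ⊎ (z < y)
  <-compare x<y z with #-cotrans (<⇒# x<y) z
  ... | inj₁ x#z with #⇒<⊎> x#z
  ...   | inj₁ x<z = inj₁ x<z
  ...   | inj₂ z<x = inj₂ (<.trans z<x x<y)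
  <-compare x<y z | inj₂ z#y with #⇒<⊎> z#y
  ...   | inj₁ z<y = inj₂ z<y
  ...   | inj₂ y<z = inj₁ (<.trans x<y y<z)

  ≤-trans : x ≤ y → y ≤ z → x ≤ z
  ≤-trans {y = y} x≤y y≤z z<x with <-compare z<x y
  ... | inj₁ z<y = y≤z z<y
  ... | inj₂ y<x = x≤y y<x

  ≤-<-trans : x ≤ y → y < z → x < z
  ≤-<-trans {x} x≤y y<z with <-compare y<z x
  ... | inj₁ y<x = ⊥-elim (x≤y y<x)
  ... | inj₂ x<z = x<z

  +-monoʳ-≤ : ∀ z → x ≤ y → z + x ≤ z + y
  +-monoʳ-≤ {x} {y} z x≤y z+y<z+x = x≤y (<-resp (cancel y) (cancel x) (+-monoʳ-< (- z) z+y<z+x))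
    where
    cancel : ∀ x → - z + (z + x) ≈ x
    cancel = solve 2 (λ z x → :- z :+ (z :+ x) := x) refl z

  +-mono-≤ : x ≤ y → u ≤ v → x + u ≤ y + v
  +-mono-≤ {x} {y} {u} {v} x≤y u≤v =
    ≤-trans (+-monoʳ-≤ x u≤v) (≤-resp (+-comm v x) (+-comm v y) (+-monoʳ-≤ v x≤y))

  ≤⇒0≤- : x ≤ y → 0# ≤ y - x
  ≤⇒0≤- {x} {y} x≤y = ≤-resp (-‿inverseˡ x) (+-comm (- x) y) (+-monoʳ-≤ (- x) x≤y)

  0≤-⇒≤ : 0# ≤ y - x → x ≤ y
  0≤-⇒≤ {y} {x} 0≤y-x = ≤-resp (+-identityʳ x)
    (solve 2 (λ x y → x :+ (y :- x) := y) refl x y) (+-monoʳ-≤ x 0≤y-x)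

  neg-anti-≤ : x ≤ y → - y ≤ - x
  neg-anti-≤ {x} {y} x≤y = 0≤-⇒≤ (≤-resp refl
    (solve 2 (λ x y → y :- x := :- x :- :- y) refl x y) (≤⇒0≤- x≤y))

  neg-anti-< : x < y → - y < - x
  neg-anti-< {x} {y} x<y = <-resp
    (solve 2 (λ x y → (:- x :- y) :+ x := :- y) refl x y)
    (solve 2 (λ x y → (:- x :- y) :+ y := :- x) refl x y) (+-monoʳ-< (- x - y) x<y)

  x#0⇒invertible : x # 0# → ∃ λ x⁻¹ → x⁻¹ * x ≈ 1#
  x#0⇒invertible x#0 with x⁻¹ , x⁻¹*[x-0]≈1 , _ ← #⇒invertible x#0 =
    x⁻¹ , trans (*-congˡ (sym (trans (+-congˡ -0#≈0#) (+-identityʳ _)))) x⁻¹*[x-0]≈1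

  *-#0ˡ : x * y # 0# → x # 0#
  *-#0ˡ {x} {y} xy#0 with z , zxy≈1 ← x#0⇒invertible xy#0 = invertible⇒#
    (z * y , trans (solve 3 (λ x y z → z :* y :* (x :- con 0ℤ) := z :* (x :* y)) refl x y z) zxy≈1
           , trans (solve 3 (λ x y z → (x :- con 0ℤ) :* (z :* y) := z :* (x :* y)) refl x y z) zxy≈1)

  ≤∧#⇒< : 0# ≤ x → x # 0# → 0# < x
  ≤∧#⇒< 0≤x x#0 with #⇒<⊎> x#0
  ... | inj₁ x<0 = ⊥-elim (0≤x x<0)
  ... | inj₂ 0<x = 0<x

  -- A negative product is apart from zero, hence so are both factors; being nonnegative they are
  -- then positive, which contradicts `*-pos`.
  *-nonneg : 0# ≤ x → 0# ≤ y → 0# ≤ x * y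
  *-nonneg {x} {y} 0≤x 0≤y xy<0 = <.asym xy<0 (*-pos
    (≤∧#⇒< 0≤x (*-#0ˡ {x} {y} (<⇒# xy<0)))
    (≤∧#⇒< 0≤y (*-#0ˡ {y} {x} (<⇒# (<-resp (*-comm x y) refl xy<0)))))

  *-monoˡ-≤ : 0# ≤ z → x ≤ y → z * x ≤ z * y
  *-monoˡ-≤ {z} {x} {y} 0≤z x≤y = 0≤-⇒≤ (≤-resp refl
    (solve 3 (λ x y z → z :* (y :- x) := z :* y :- z :* x) refl x y z) (*-nonneg 0≤z (≤⇒0≤- x≤y)))

  1/-inverse : ∀ n (n>0 : 0 ℕ.< n) → 1/ n n>0 * fromℕ n ≈ 1#
  1/-inverse n n>0 = proj₂ (x#0⇒invertible (fromℕ#0 n>0))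

  0≤1 : 0# ≤ 1#
  0≤1 1<0 = <.asym 1<0 (<-resp refl [-1]²≈1 (*-pos 0<-1 0<-1))
    where
    0<-1 : 0# < - 1#
    0<-1 = <-resp -0#≈0# refl (neg-anti-< 1<0)
    [-1]²≈1 : - 1# * - 1# ≈ 1#
    [-1]²≈1 = trans (solve 1 (λ x → :- x :* :- x := x :* x) refl 1#) (*-identityˡ 1#)

  0≤fromℕ : ∀ n → 0# ≤ fromℕ n
  0≤fromℕ zero    = ≤-reflexive refl
  0≤fromℕ (suc n) = ≤-resp (+-identityˡ 0#) refl (+-mono-≤ 0≤1 (0≤fromℕ n))

  0<fromℕ : ∀ {n} → 0 ℕ.< n → 0# < fromℕ n
  0<fromℕ {n} n>0 = ≤∧#⇒< (0≤fromℕ n) (fromℕ#0 n>0)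

  0<inverse : 0# < y → x * y ≈ 1# → 0# < x
  0<inverse {y} {x} 0<y xy≈1 = ≤∧#⇒< 0≤x (*-#0ˡ {x} {y} (#-sym (<⇒# 0<xy)))
    where
    0<1 : 0# < 1#
    0<1 = <-resp refl (+-identityʳ 1#) (0<fromℕ {1} (s≤s z≤n))
    0<xy : 0# < x * y
    0<xy = <-resp refl (sym xy≈1) 0<1
    0≤x : 0# ≤ x
    0≤x x<0 = <.asym 0<xy (<-resp
      (solve 2 (λ x y → :- (:- x :* y) := x :* y) refl x y) -0#≈0#
      (neg-anti-< (*-pos (<-resp -0#≈0# refl (neg-anti-< x<0)) 0<y)))

  0<1/ : ∀ n (n>0 : 0 ℕ.< n) → 0# < 1/ n n>0
  0<1/ n n>0 = 0<inverse (0<fromℕ n>0) (1/-inverse n n>0)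

  fromℕ-mono-≤ : ∀ {m n} → m ℕ.≤ n → fromℕ m ≤ fromℕ n
  fromℕ-mono-≤ {m} {n} m≤n = ≤-resp (+-identityʳ _)
    (trans (sym (×-homo-+ semiring 1# m (n ℕ.∸ m))) (reflexive (cong fromℕ (ℕ.m+[n∸m]≡n m≤n))))
    (+-monoʳ-≤ (fromℕ m) (0≤fromℕ (n ℕ.∸ m)))

  *-cancelʳ-fromℕ : ∀ {n} → 0 ℕ.< n → x * fromℕ n ≈ y * fromℕ n → x ≈ y
  *-cancelʳ-fromℕ {x} {y} {n} n>0 xn≈yn = begin
    x                          ≈⟨ *-identityˡ x ⟨
    1# * x                     ≈⟨ *-congʳ (1/-inverse n n>0) ⟨
    1/ n n>0 * fromℕ n * x     ≈⟨ *-assoc _ _ _ ⟩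
    1/ n n>0 * (fromℕ n * x)   ≈⟨ *-congˡ (trans (*-comm _ _) (trans xn≈yn (*-comm _ _))) ⟩
    1/ n n>0 * (fromℕ n * y)   ≈⟨ *-assoc _ _ _ ⟨
    1/ n n>0 * fromℕ n * y     ≈⟨ *-congʳ (1/-inverse n n>0) ⟩
    1# * y                     ≈⟨ *-identityˡ y ⟩
    y ∎

  */-cancel : ∀ x n (n>0 : 0 ℕ.< n) → x * 1/ n n>0 * fromℕ n ≈ x
  */-cancel x n n>0 = trans (*-assoc _ _ _) (trans (*-congˡ (1/-inverse n n>0)) (*-identityʳ x))

-- Lattice polytopes, interiors and duals under invertible integer linear maps.

module LatticePolytopes {c ℓ₁ ℓ₂} (ℝ : RealField c ℓ₁ ℓ₂) where
  open RealField ℝ hiding (zero)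
  open Polytopes ℝ
  open OrderedField ℝ
  open CommutativeRing commutativeRing using (semiring)
  open RingProperties ring using (-0#≈0#; -‿+-comm)
  open SetoidReasoning setoid
  open SemiringSum semiring using (sum-cong-≋; ∑-distrib-+)
  open Determinant
  module ℝMatrix = MatrixAction semiring

  private
    variable
      d n : ℕ
      p q : Level

  sum-cong : {f g : Vector Carrier n} → (∀ i → f i ≈ g i) → sum f ≈ sum g
  sum-cong = sum-cong-≋

  sum-neg : (f : Vector Carrier n) → sum (λ i → - f i) ≈ - sum f
  sum-neg {zero}  f = sym -0#≈0#
  sum-neg {suc n} f = trans (+-congˡ (sum-neg (tail f))) (-‿+-comm _ _)

  fromℤ-sum : (f : Vector ℤ n) → fromℤ (sumℤ f) ≈ sum (fromℤ ∘ f)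
  fromℤ-sum {zero}  f = refl
  fromℤ-sum {suc n} f = trans (fromℤ-+ (f zero) (sumℤ (tail f))) (+-congˡ (fromℤ-sum (tail f)))

  linearMapℤ : Matrix d → Vector ℤ d → Vector ℤ d
  linearMapℤ U z j = sumℤ λ i → z i ℤ.* U i j

  linearMapℤ-inverse : (U V : Matrix d) → ℤMatrix.Identity (product U V) →
    ∀ z j → linearMapℤ V (linearMapℤ U z) j ≡ z j
  linearMapℤ-inverse U V UV z j =
    ≡.trans (ℤMatrix.mul-assoc z U (λ k → V k j)) (ℤMatrix.mul-identityʳ UV z j)

  linearMap-cong : (U : Matrix d) {x y : Point d} → x ≈ᵥ y → linearMap U x ≈ᵥ linearMap U y
  linearMap-cong U x≈y j = sum-cong λ i → *-congʳ (x≈y i)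

  linearMap-+ : (U : Matrix d) (x y : Point d) →
    linearMap U (λ j → x j + y j) ≈ᵥ λ j → linearMap U x j + linearMap U y j
  linearMap-+ U x y j = trans (sum-cong λ i → distribʳ (fromℤ (U i j)) (x i) (y i))
    (∑-distrib-+ (λ i → x i * fromℤ (U i j)) (λ i → y i * fromℤ (U i j)))

  linearMap-ι : (U : Matrix d) (z : Vector ℤ d) → linearMap U (ι z) ≈ᵥ ι (linearMapℤ U z)
  linearMap-ι U z j = sym (trans (fromℤ-sum (λ i → z i ℤ.* U i j))
    (sum-cong λ i → fromℤ-* (z i) (U i j)))

  linearMap-identity : (I : Matrix d) → ℤMatrix.Identity I → ∀ x → linearMap I x ≈ᵥ x
  linearMap-identity I (diag , off) = ℝMatrix.mul-identityʳ
    ( (λ i → trans (reflexive (cong fromℤ (diag i))) fromℤ-1)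
    , (λ i j i≢j → reflexive (cong fromℤ (off i j i≢j))) )

  linearMap-inverse : (U V : Matrix d) → ℤMatrix.Identity (product U V) →
    ∀ x → linearMap V (linearMap U x) ≈ᵥ x
  linearMap-inverse U V UV x k = begin
    linearMap V (linearMap U x) k
      ≈⟨ ℝMatrix.mul-assoc x (λ i j → fromℤ (U i j)) (λ j → fromℤ (V j k)) ⟩
    sum (λ i → x i * sum (λ j → fromℤ (U i j) * fromℤ (V j k)))
      ≈⟨ sum-cong (λ i → *-congˡ (trans (sum-cong λ j → sym (fromℤ-* (U i j) (V j k)))
           (sym (fromℤ-sum (λ j → U i j ℤ.* V j k))))) ⟩
    linearMap (product U V) x k
      ≈⟨ linearMap-identity (product U V) UV x k ⟩
    x k ∎

  linearMap-combination : (U : Matrix d) (μ : Vector Carrier n) (v : Vector (Point d) n) →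
    linearMap U (λ j → sum λ i → μ i * v i j) ≈ᵥ λ j → sum λ i → μ i * linearMap U (v i) j
  linearMap-combination U μ v j = ℝMatrix.mul-assoc μ v (λ k → fromℤ (U k j))

  ⟨,⟩-linearMap : (U : Matrix d) (x y : Point d) →
    ⟨ linearMap U x , y ⟩ ≈ ⟨ x , linearMap (flip U) y ⟩
  ⟨,⟩-linearMap U x y = trans (ℝMatrix.mul-assoc x (λ i j → fromℤ (U i j)) y)
    (sum-cong λ i → *-congˡ (sum-cong λ j → *-comm (fromℤ (U i j)) (y j)))

  ⟨,⟩-cong : {x x′ y y′ : Point d} → x ≈ᵥ x′ → y ≈ᵥ y′ → ⟨ x , y ⟩ ≈ ⟨ x′ , y′ ⟩
  ⟨,⟩-cong x≈x′ y≈y′ = sum-cong λ j → *-cong (x≈x′ j) (y≈y′ j)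

  bounded : (f : Fin n → ℕ) → ∃ λ N → ∀ i → f i ℕ.≤ N
  bounded {zero}  f = 0 , λ ()
  bounded {suc n} f with N , f≤N ← bounded (tail f) = f zero ℕ.+ N ,
    λ { zero → ℕ.m≤m+n (f zero) N ; (suc i) → ℕ.m≤n⇒m≤o+n (f zero) (f≤N i) }

  ‖_‖₁ : Vector ℤ n → ℕ
  ‖_‖₁ {zero}  a = 0
  ‖_‖₁ {suc n} a = ℤ.∣ a zero ∣ ℕ.+ ‖ tail a ‖₁

  -- The sign of the integer, which is decidable, selects which of the two bounds on `z` is used.
  *-fromℤ-≤ : ∀ {δ z} → z ≤ δ → - δ ≤ z → ∀ i → z * fromℤ i ≤ fromℕ ℤ.∣ i ∣ * δ
  *-fromℤ-≤ {δ} {z} z≤δ -δ≤z (ℤ.+ n) = ≤-resp (*-comm _ z) refl (*-monoˡ-≤ (0≤fromℕ n) z≤δ)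
  *-fromℤ-≤ {δ} {z} z≤δ -δ≤z -[1+ n ] = ≤-resp
    (solve 2 (λ z x → x :* (:- z) := z :* (:- x)) refl z (fromℕ (suc n)))
    (solve 2 (λ δ x → x :* (:- :- δ) := x :* δ) refl δ (fromℕ (suc n)))
    (*-monoˡ-≤ (0≤fromℕ (suc n)) (neg-anti-≤ -δ≤z))

  ⟨,ι⟩-≤ : ∀ {δ} (z : Point n) (a : Vector ℤ n) → (∀ i → z i ≤ δ) → (∀ i → - δ ≤ z i) →
    ⟨ z , ι a ⟩ ≤ fromℕ ‖ a ‖₁ * δ
  ⟨,ι⟩-≤ {zero}  {δ} z a z≤δ -δ≤z = ≤-reflexive (sym (zeroˡ δ))
  ⟨,ι⟩-≤ {suc n} {δ} z a z≤δ -δ≤z = ≤-resp refl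
    (trans (sym (distribʳ δ _ _)) (*-congʳ (sym (fromℤ-+ (ℤ.+ ℤ.∣ a zero ∣) (ℤ.+ ‖ tail a ‖₁)))))
    (+-mono-≤ (*-fromℤ-≤ (z≤δ zero) (-δ≤z zero) (a zero))
      (⟨,ι⟩-≤ (tail z) (tail a) (z≤δ ∘ suc) (-δ≤z ∘ suc)))

  -- Continuity at the origin: each coordinate of the image is at most `δ` times the absolute sum of
  -- a column. The lower bound is the upper bound applied to `- z`.
  linearMap-small : (U : Matrix d) → ∀ {ε} → 0# < ε → ∃ λ δ → (0# < δ) ×
    (∀ z → (∀ j → (- δ < z j) × (z j < δ)) → ∀ j → (- ε < linearMap U z j) × (linearMap U z j < ε))
  linearMap-small {d} U {ε} 0<ε = δ , 0<δ , λ z z-small j →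
      <-resp refl
        (trans (-‿cong (trans (sum-cong λ i → neg-* (z i) (fromℤ (U i j)))
            (sum-neg λ i → z i * fromℤ (U i j))))
          (solve 1 (λ x → :- :- x := x) refl (linearMap U z j)))
        (neg-anti-< (upper (λ i → - z i) j
          (λ i → ≤-resp refl (solve 1 (λ x → :- :- x := x) refl δ)
            (neg-anti-≤ (<⇒≤ (proj₁ (z-small i)))))
          (λ i → neg-anti-≤ (<⇒≤ (proj₂ (z-small i))))))
    , upper z j (λ i → <⇒≤ (proj₂ (z-small i))) (λ i → <⇒≤ (proj₁ (z-small i)))
    where
    neg-* : ∀ x y → - x * y ≈ - (x * y)
    neg-* = solve 2 (λ x y → :- x :* y := :- (x :* y)) refl
    column-bound : ∃ λ N → ∀ j → ‖ flip U j ‖₁ ℕ.≤ N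
    column-bound = bounded λ j → ‖ flip U j ‖₁
    N : ℕ
    N = proj₁ column-bound
    -- Dividing by `N + 1` keeps the denominator positive when `N` is zero and makes `N * δ < ε`
    -- strict.
    δ : Carrier
    δ = ε * 1/ (suc N) (s≤s z≤n)
    0<δ : 0# < δ
    0<δ = *-pos 0<ε (0<1/ (suc N) (s≤s z≤n))
    N*δ<ε : fromℕ N * δ < ε
    N*δ<ε = <-resp (+-identityʳ _) (begin
      fromℕ N * δ + δ            ≈⟨ +-congˡ (*-identityˡ δ) ⟨
      fromℕ N * δ + 1# * δ       ≈⟨ distribʳ δ (fromℕ N) 1# ⟨
      (fromℕ N + 1#) * δ         ≈⟨ *-congʳ (+-comm (fromℕ N) 1#) ⟩
      fromℕ (suc N) * δ          ≈⟨ *-comm (fromℕ (suc N)) δ ⟩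
      δ * fromℕ (suc N)          ≈⟨ */-cancel ε (suc N) (s≤s z≤n) ⟩
      ε ∎) (+-monoʳ-< (fromℕ N * δ) 0<δ)
    upper : ∀ z j → (∀ i → z i ≤ δ) → (∀ i → - δ ≤ z i) → linearMap U z j < ε
    upper z j z≤δ -δ≤z = ≤-<-trans (⟨,ι⟩-≤ z (flip U j) z≤δ -δ≤z) (≤-<-trans
      (≤-resp (*-comm δ _) (*-comm δ _)
        (*-monoˡ-≤ (<⇒≤ 0<δ) (fromℕ-mono-≤ (proj₂ column-bound j))))
      N*δ<ε)

  Box : Point d → Carrier → Point d → Set ℓ₂
  Box x ε y = ∀ j → (x j - ε < y j) × (y j < x j + ε)

  box-resp : ∀ {x x′ y : Point d} {ε} → x ≈ᵥ x′ → Box x ε y → Box x′ ε y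
  box-resp x≈x′ y∈box j =
    <-resp (+-congʳ (x≈x′ j)) refl (proj₁ (y∈box j)) ,
    <-resp refl (+-congʳ (x≈x′ j)) (proj₂ (y∈box j))

  -- By linearity the bound at the origin, applied to `y - x`, gives a `δ` that is uniform in `x`.
  linearMap-continuous : (U : Matrix d) → ∀ {ε} → 0# < ε → ∃ λ δ → (0# < δ) ×
    (∀ x y → Box x δ y → Box (linearMap U x) ε (linearMap U y))
  linearMap-continuous U {ε} 0<ε =
    let δ , 0<δ , small = linearMap-small U 0<ε in δ , 0<δ , λ x y y∈box j →
      from-difference (linearMap-difference x y j)
        (small (λ i → y i - x i) (λ i → to-difference (y∈box i)) j)
    where
    to-difference : ∀ {x y δ} → (x - δ < y) × (y < x + δ) → (- δ < y - x) × (y - x < δ)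
    to-difference {x} {y} {δ} (x-δ<y , y<x+δ) =
      <-resp (solve 2 (λ x δ → :- x :+ (x :- δ) := :- δ) refl x δ) (+-comm (- x) y)
        (+-monoʳ-< (- x) x-δ<y) ,
      <-resp (+-comm (- x) y) (solve 2 (λ x δ → :- x :+ (x :+ δ) := δ) refl x δ)
        (+-monoʳ-< (- x) y<x+δ)
    from-difference : ∀ {x y z} → x + z ≈ y → (- ε < z) × (z < ε) → (x - ε < y) × (y < x + ε)
    from-difference {x} x+z≈y (-ε<z , z<ε) =
      <-resp refl x+z≈y (+-monoʳ-< x -ε<z) , <-resp x+z≈y refl (+-monoʳ-< x z<ε)
    linearMap-difference : ∀ x y j →
      linearMap U x j + linearMap U (λ i → y i - x i) j ≈ linearMap U y j
    linearMap-difference x y j = trans (sym (linearMap-+ U x (λ i → y i - x i) j))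
      (linearMap-cong U (λ i → solve 2 (λ x y → x :+ (y :- x) := y) refl (x i) (y i)) j)

  convexHull-resp : (v : Vector (Point d) n) → convexHull v Respects _≈ᵥ_
  convexHull-resp v x≈y (μ , μ≥0 , ∑μ≈1 , x≈∑) = μ , μ≥0 , ∑μ≈1 , λ j → trans (sym (x≈y j)) (x≈∑ j)

  convexHull-cong : {v w : Vector (Point d) n} → (∀ i → v i ≈ᵥ w i) → convexHull v ⊆ convexHull w
  convexHull-cong v≈w (μ , μ≥0 , ∑μ≈1 , x≈∑) = μ , μ≥0 , ∑μ≈1 ,
    λ j → trans (x≈∑ j) (sum-cong λ i → *-congˡ (v≈w i j))

  convexHull-linearMap : (U : Matrix d) (v : Vector (Point d) n) {x : Point d} →
    convexHull v x → convexHull (λ i → linearMap U (v i)) (linearMap U x)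
  convexHull-linearMap U v (μ , μ≥0 , ∑μ≈1 , x≈∑) = μ , μ≥0 , ∑μ≈1 ,
    λ j → trans (linearMap-cong U x≈∑ j) (linearMap-combination U μ v j)

  interior-resp : (P : Pred (Point d) p) → interior P Respects _≈ᵥ_
  interior-resp P x≈y (ε , 0<ε , box) = ε , 0<ε , λ u u∈box →
    box u (box-resp (λ j → sym (x≈y j)) u∈box)

  -- The inverse matrix is part of the data, so the notion is symmetric and each transport is proved
  -- in one direction only. The `Respects` fields allow a point to be replaced by its round trip
  -- through `U` and `V`, which is equal to it only up to `_≈ᵥ_`.
  record IntegrallyEquivalent (P : Pred (Point d) p) (Q : Pred (Point d) q) (U V : Matrix d) :
      Set (c ⊔ ℓ₁ ⊔ p ⊔ q) where
    field
      inverses : Inverses U V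
      respˡ    : P Respects _≈ᵥ_
      respʳ    : Q Respects _≈ᵥ_
      to       : ∀ {x} → P x → Q (linearMap U x)
      from     : ∀ {y} → Q y → P (linearMap V y)

    VU≈id : ∀ x → linearMap V (linearMap U x) ≈ᵥ x
    VU≈id = linearMap-inverse U V (proj₁ inverses)

    UV≈id : ∀ y → linearMap U (linearMap V y) ≈ᵥ y
    UV≈id = linearMap-inverse V U (proj₂ inverses)

    -- A box around linearMap U x that lies in Q is pulled back from a box around x.
    interior-to : ∀ {x} → x ∈ interior P → linearMap U x ∈ interior Q
    interior-to {x} (ε , 0<ε , box) =
      let δ , 0<δ , continuous = linearMap-continuous V 0<ε in
      δ , 0<δ , λ y y∈box → respʳ (UV≈id y) (to (box (linearMap V y)
        (box-resp {x = linearMap V (linearMap U x)} {x} (VU≈id x)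
          (continuous (linearMap U x) y y∈box))))

    isLatticePolytope : IsLatticePolytope P → IsLatticePolytope Q
    isLatticePolytope (n , v , P⊆ , ⊆P) = n , (λ i → linearMapℤ U (v i)) , Q⊆ , ⊆Q
      where
      Q⊆ : Q ⊆ convexHull (λ i → ι (linearMapℤ U (v i)))
      Q⊆ {y} y∈Q = convexHull-cong (λ i → linearMap-ι U (v i))
        (convexHull-resp (λ i → linearMap U (ι (v i))) (UV≈id y)
          (convexHull-linearMap U (λ i → ι (v i)) (P⊆ (from y∈Q))))
      ⊆Q : convexHull (λ i → ι (linearMapℤ U (v i))) ⊆ Q
      ⊆Q {y} y∈hull = respʳ (UV≈id y) (to (⊆P
        (convexHull-cong (λ i j → trans (linearMap-ι V (linearMapℤ U (v i)) j)
            (reflexive (cong fromℤ (linearMapℤ-inverse U V (proj₁ inverses) (v i) j))))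
          (convexHull-linearMap V (λ i → ι (linearMapℤ U (v i))) y∈hull))))

    isFullDimensional : IsFullDimensional P → IsFullDimensional Q
    isFullDimensional (v , v∈P , independent) =
      (λ i → linearMap U (v i)) , (λ i → to (v∈P i)) ,
      -- A dependence among the images is carried back by `V` to one among the original points.
      λ μ ∑μ≈0 ∑μv≈0 → independent μ ∑μ≈0 λ j → begin
        sum (λ i → μ i * v i j)
          ≈⟨ sum-cong {f = λ i → μ i * linearMap V (linearMap U (v i)) j}
               (λ i → *-congˡ (VU≈id (v i) j)) ⟨
        sum (λ i → μ i * linearMap V (linearMap U (v i)) j)
          ≈⟨ linearMap-combination V μ (λ i → linearMap U (v i)) j ⟨
        linearMap V (λ k → sum λ i → μ i * linearMap U (v i) k) j
          ≈⟨ ℝMatrix.sum-zero _ (λ k → trans (*-congʳ (∑μv≈0 k)) (zeroˡ (fromℤ (V k j)))) ⟩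
        0# ∎

  symmetric : {P : Pred (Point d) p} {Q : Pred (Point d) q} {U V : Matrix d} →
    IntegrallyEquivalent P Q U V → IntegrallyEquivalent Q P V U
  symmetric e = record
    { inverses = proj₂ inverses , proj₁ inverses ; respˡ = respʳ ; respʳ = respˡ
    ; to = from ; from = to }
    where open IntegrallyEquivalent e

  dual-resp : (P : Pred (Point d) p) → dual P Respects _≈ᵥ_
  dual-resp P y≈y′ y∈dual x x∈P = ≤-resp (⟨,⟩-cong {x = x} (λ _ → refl) y≈y′) refl (y∈dual x x∈P)

  -- Moving `V` across the pairing transposes it: testing `yVᵀ` against `x` in `Q` is testing `y`
  -- against `xV`, which lies in `P`.
  dual-equivalent : {P : Pred (Point d) p} {Q : Pred (Point d) q} {U V : Matrix d} →
    IntegrallyEquivalent P Q U V → IntegrallyEquivalent (dual P) (dual Q) (flip V) (flip U)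
  dual-equivalent {P = P} {Q} {U} {V} e = record
    { inverses = inverses-transpose {U = V} {U} (proj₂ inverses , proj₁ inverses)
    ; respˡ = dual-resp P ; respʳ = dual-resp Q
    ; to   = λ {y} y∈dual x x∈Q →
        ≤-resp (⟨,⟩-linearMap V x y) refl (y∈dual (linearMap V x) (from x∈Q))
    ; from = λ {y} y∈dual x x∈P →
        ≤-resp (⟨,⟩-linearMap U x y) refl (y∈dual (linearMap U x) (to x∈P)) }
    where open IntegrallyEquivalent e

  isReflexive : {P : Pred (Point d) p} {Q : Pred (Point d) q} {U V : Matrix d} →
    IntegrallyEquivalent P Q U V → IsReflexive P → IsReflexive Q
  isReflexive {d = d} {P = P} {Q} {U} {V} e
      (((lattice , full) , 0∈interior , unique) , dual-lattice) =
    ( (isLatticePolytope lattice , isFullDimensional full)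
    , interior-resp Q
        (λ j → trans (linearMap-ι U (λ _ → 0ℤ) j) (reflexive (cong fromℤ (linearMapℤ-0 U j))))
        (interior-to 0∈interior)
    -- The lattice point `zV` is interior to `P`, hence zero, and `z` is its image under `U`.
    , λ z z∈interior j → ≡.trans (≡.sym (linearMapℤ-inverse V U (proj₂ inverses) z j))
        (ℤMatrix.sum-zero (λ i → linearMapℤ V z i ℤ.* U i j) λ i → cong (ℤ._* U i j)
          (unique (linearMapℤ V z) (interior-resp P (linearMap-ι V z)
            (IntegrallyEquivalent.interior-to (symmetric e) z∈interior)) i)) )
    , IntegrallyEquivalent.isLatticePolytope (dual-equivalent e) dual-lattice
    where
    open IntegrallyEquivalent e
    linearMapℤ-0 : (U : Matrix d) → ∀ j → linearMapℤ U (λ _ → 0ℤ) j ≡ 0ℤ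
    linearMapℤ-0 U j = ℤMatrix.sum-zero (λ i → 0ℤ ℤ.* U i j) λ i → ≡.refl

-- Lecture hall polytopes as lattice simplices, and their dilations.

module LectureHall {c ℓ₁ ℓ₂} (ℝ : RealField c ℓ₁ ℓ₂) where
  open RealField ℝ hiding (zero)
  open Polytopes ℝ
  open OrderedField ℝ
  open LatticePolytopes ℝ
  open Determinant
  open SetoidReasoning setoid

  private
    variable
      d n : ℕ
      p q : Level

  -- The inequalities of the lecture hall polytope in a form suited to induction: `b` is the
  -- preceding term, starting at zero.
  Chain : Carrier → Vector Carrier n → Set ℓ₂
  Chain {zero}  b r = b ≤ 1#
  Chain {suc n} b r = (b ≤ r zero) × Chain (r zero) (tail r)

  gaps : Carrier → Vector Carrier n → Vector Carrier (suc n)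
  gaps {n}     b r zero    = top b r - b
    where
    top : ∀ {n} → Carrier → Vector Carrier n → Carrier
    top {zero}  b r = 1#
    top {suc n} b r = r zero
  gaps {suc n} b r (suc i) = gaps (r zero) (tail r) i

  -- Inverse to `gaps`: recovers the ratios from barycentric coordinates. The last coordinate does
  -- not enter, being determined by the total.
  partialSums : Carrier → Vector Carrier (suc n) → Vector Carrier n
  partialSums b μ zero    = b + μ zero
  partialSums b μ (suc j) = partialSums (b + μ zero) (tail μ) j

  chain-resp : ∀ {b b′} {r r′ : Vector Carrier n} → b ≈ b′ → (∀ j → r j ≈ r′ j) →
    Chain b r → Chain b′ r′
  chain-resp {zero}  b≈b′ r≈r′ b≤1 = ≤-resp b≈b′ refl b≤1
  chain-resp {suc n} b≈b′ r≈r′ (b≤r , chain) =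
    ≤-resp b≈b′ (r≈r′ zero) b≤r , chain-resp (r≈r′ zero) (r≈r′ ∘ suc) chain

  gaps-nonneg : ∀ {b} {r : Vector Carrier n} → Chain b r → ∀ i → 0# ≤ gaps b r i
  gaps-nonneg {zero}  b≤1           zero    = ≤⇒0≤- b≤1
  gaps-nonneg {suc n} (b≤r , chain) zero    = ≤⇒0≤- b≤r
  gaps-nonneg {suc n} (b≤r , chain) (suc i) = gaps-nonneg chain i

  sum-gaps : ∀ b (r : Vector Carrier n) → b + sum (gaps b r) ≈ 1#
  sum-gaps {zero}  b r = solve 2 (λ b x → b :+ (x :- b :+ con 0ℤ) := x) refl b 1#
  sum-gaps {suc n} b r = trans
    (solve 3 (λ b x s → b :+ (x :- b :+ s) := x :+ s) refl b (r zero) (sum (gaps (r zero) (tail r))))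
    (sum-gaps (r zero) (tail r))

  partialSums-cong : ∀ {b b′} (μ : Vector Carrier (suc n)) → b ≈ b′ → ∀ j →
    partialSums b μ j ≈ partialSums b′ μ j
  partialSums-cong μ b≈b′ zero    = +-congʳ b≈b′
  partialSums-cong μ b≈b′ (suc j) = partialSums-cong (tail μ) (+-congʳ b≈b′) j

  partialSums-gaps : ∀ b (r : Vector Carrier n) j → partialSums b (gaps b r) j ≈ r j
  partialSums-gaps b r zero    = solve 2 (λ b x → b :+ (x :- b) := x) refl b (r zero)
  partialSums-gaps b r (suc j) = trans
    (partialSums-cong (gaps (r zero) (tail r))
      (solve 2 (λ b x → b :+ (x :- b) := x) refl b (r zero)) j)
    (partialSums-gaps (r zero) (tail r) j)

  partialSums-chain : ∀ {b} (μ : Vector Carrier (suc n)) → (∀ i → 0# ≤ μ i) → b + sum μ ≈ 1# →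
    Chain b (partialSums b μ)
  partialSums-chain {zero} {b} μ μ≥0 b+∑μ≈1 = ≤-resp (+-identityʳ b)
    (trans (+-congˡ (sym (+-identityʳ (μ zero)))) b+∑μ≈1) (+-monoʳ-≤ b (μ≥0 zero))
  partialSums-chain {suc n} {b} μ μ≥0 b+∑μ≈1 =
    ≤-resp (+-identityʳ b) refl (+-monoʳ-≤ b (μ≥0 zero)) ,
    partialSums-chain (tail μ) (μ≥0 ∘ suc) (trans (+-assoc b (μ zero) _) b+∑μ≈1)

  -- Each coefficient is a difference of consecutive partial sums; for the last one the total plays
  -- the part of the missing partial sum.
  partialSums≈0⇒≈0 : ∀ {b} (μ : Vector Carrier (suc n)) → b ≈ 0# → b + sum μ ≈ 0# →
    (∀ j → partialSums b μ j ≈ 0#) → ∀ i → μ i ≈ 0#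
  partialSums≈0⇒≈0 {zero} {b} μ b≈0 b+∑μ≈0 sums≈0 zero = begin
    μ zero                 ≈⟨ solve 2 (λ b x → x := (b :+ (x :+ con 0ℤ)) :- b) refl b (μ zero) ⟩
    (b + sum μ) - b        ≈⟨ +-cong b+∑μ≈0 (-‿cong b≈0) ⟩
    0# - 0#                ≈⟨ -‿inverseʳ 0# ⟩
    0# ∎
  partialSums≈0⇒≈0 {suc n} {b} μ b≈0 b+∑μ≈0 sums≈0 zero = begin
    μ zero                 ≈⟨ solve 2 (λ b x → x := (b :+ x) :- b) refl b (μ zero) ⟩
    (b + μ zero) - b       ≈⟨ +-cong (sums≈0 zero) (-‿cong b≈0) ⟩
    0# - 0#                ≈⟨ -‿inverseʳ 0# ⟩
    0# ∎
  partialSums≈0⇒≈0 {suc n} {b} μ b≈0 b+∑μ≈0 sums≈0 (suc i) =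
    partialSums≈0⇒≈0 (tail μ) (sums≈0 zero) (trans (+-assoc b (μ zero) _) b+∑μ≈0) (sums≈0 ∘ suc) i

  -- The i-th vertex is (0, …, 0, sᵢ, …, s_{d-1}), indices counted from zero.
  vertex : (Fin d → ℕ) → Fin (suc d) → Vector ℤ d
  vertex         s zero    j       = ℤ.+ s j
  vertex {suc d} s (suc i) zero    = 0ℤ
  vertex {suc d} s (suc i) (suc j) = vertex (tail s) i j

  -- Vertex `i` has `j`-th coordinate `s j` when `i` is at most `j` and zero otherwise, so
  -- coordinate `j` collects the first `j + 1` weights. The offset `b` holds the weights already
  -- passed in the induction.
  vertex-combination : ∀ b (s : Fin d → ℕ) (μ : Vector Carrier (suc d)) j →
    b * fromℕ (s j) + sum (λ i → μ i * ι (vertex s i) j) ≈ partialSums b μ j * fromℕ (s j)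
  vertex-combination b s μ zero = begin
    b * fromℕ (s zero) + (μ zero * fromℕ (s zero) + sum (λ i → μ (suc i) * 0#))
      ≈⟨ +-congˡ (+-congˡ (ℝMatrix.sum-zero (λ i → μ (suc i) * 0#) λ i → zeroʳ (μ (suc i)))) ⟩
    b * fromℕ (s zero) + (μ zero * fromℕ (s zero) + 0#)
      ≈⟨ solve 3 (λ b x s → b :* s :+ (x :* s :+ con 0ℤ) := (b :+ x) :* s) refl
           b (μ zero) (fromℕ (s zero)) ⟩
    (b + μ zero) * fromℕ (s zero) ∎
  vertex-combination b s μ (suc j) = begin
    b * fromℕ (s (suc j)) + (μ zero * fromℕ (s (suc j)) + rest)
      ≈⟨ solve 4 (λ b x s r → b :* s :+ (x :* s :+ r) := (b :+ x) :* s :+ r) refl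
           b (μ zero) (fromℕ (s (suc j))) rest ⟩
    (b + μ zero) * fromℕ (s (suc j)) + rest
      ≈⟨ vertex-combination (b + μ zero) (tail s) (tail μ) j ⟩
    partialSums b μ (suc j) * fromℕ (s (suc j)) ∎
    where
    rest : Carrier
    rest = sum (λ i → μ (suc i) * ι (vertex (tail s) i) j)

  vertex-combination₀ : ∀ (s : Fin d → ℕ) (μ : Vector Carrier (suc d)) j →
    sum (λ i → μ i * ι (vertex s i) j) ≈ partialSums 0# μ j * fromℕ (s j)
  vertex-combination₀ s μ j = trans
    (solve 2 (λ x s → x := con 0ℤ :* s :+ x) refl (sum (λ i → μ i * ι (vertex s i) j)) (fromℕ (s j)))
    (vertex-combination 0# s μ j)

  ratio : (s : Fin d → ℕ) → (∀ j → 0 ℕ.< s j) → Point d → Vector Carrier d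
  ratio s s>0 x j = x j * 1/ (s j) (s>0 j)

  -- The premise for `d ≡ 0` covers the end of the recursion, where the bound by one concerns the
  -- term just removed.
  increasing⇒chain : ∀ b (r : Vector Carrier d) → (d ≡ 0 → b ≤ 1#) →
    (∀ j → toℕ j ≡ 0 → b ≤ r j) →
    (∀ j j′ → toℕ j′ ≡ suc (toℕ j) → r j ≤ r j′) →
    (∀ j → suc (toℕ j) ≡ d → r j ≤ 1#) → Chain b r
  increasing⇒chain {zero}  b r empty first steps last = empty ≡.refl
  increasing⇒chain {suc d} b r empty first steps last = first zero ≡.refl ,
    increasing⇒chain (r zero) (tail r) (λ d≡0 → last zero (cong suc (≡.sym d≡0)))
      (λ j j≡0 → steps zero (suc j) (cong suc j≡0))
      (λ j j′ eq → steps (suc j) (suc j′) (cong suc eq))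
      (λ j eq → last (suc j) (cong suc eq))

  chain⇒increasing : ∀ b (r : Vector Carrier d) → Chain b r →
    (∀ j → toℕ j ≡ 0 → b ≤ r j) ×
    (∀ j j′ → toℕ j′ ≡ suc (toℕ j) → r j ≤ r j′) ×
    (∀ j → suc (toℕ j) ≡ d → r j ≤ 1#)
  chain⇒increasing {zero} b r _ = (λ ()) , (λ ()) , λ ()
  chain⇒increasing {suc d} b r (b≤r , chain)
    with first , steps , last ← chain⇒increasing (r zero) (tail r) chain
    = (λ { zero _ → b≤r })
    , (λ { zero (suc j′) eq → first j′ (ℕ.suc-injective eq)
         ; (suc j) (suc j′) eq → steps j j′ (ℕ.suc-injective eq) })
    , (λ { zero eq → last-step (ℕ.suc-injective eq) chain
         ; (suc j) eq → last j (ℕ.suc-injective eq) })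
    where
    last-step : ∀ {d} {b : Carrier} {r : Vector Carrier d} → 0 ≡ d → Chain b r → b ≤ 1#
    last-step ≡.refl b≤1 = b≤1

  module _ (s : Fin d → ℕ) (s>0 : ∀ j → 0 ℕ.< s j) where

    lectureHall⇒chain : ∀ x → lectureHall s s>0 x → Chain 0# (ratio s s>0 x)
    lectureHall⇒chain x (first , steps , last) =
      increasing⇒chain 0# (ratio s s>0 x) (λ _ → 0≤1) first steps last

    chain⇒lectureHall : ∀ x → Chain 0# (ratio s s>0 x) → lectureHall s s>0 x
    chain⇒lectureHall x = chain⇒increasing 0# (ratio s s>0 x)

  -- Membership depends on the ratios alone. This gives both compatibility with `_≈ᵥ_` and the
  -- behaviour under dilation.
  lectureHall-ratio : ∀ (s t : Fin d → ℕ) s>0 t>0 (x y : Point d) →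
    (∀ j → ratio s s>0 x j ≈ ratio t t>0 y j) → lectureHall s s>0 x → lectureHall t t>0 y
  lectureHall-ratio s t s>0 t>0 x y ratio≈ x∈LH = chain⇒lectureHall t t>0 y
    (chain-resp {r = ratio s s>0 x} refl ratio≈ (lectureHall⇒chain s s>0 x x∈LH))

  lectureHall-resp : (s : Fin d → ℕ) (s>0 : ∀ j → 0 ℕ.< s j) → lectureHall s s>0 Respects _≈ᵥ_
  lectureHall-resp s s>0 {x} {y} x≈y = lectureHall-ratio s s s>0 s>0 x y λ j → *-congʳ (x≈y j)

  lectureHall≐convexHull : (s : Fin d → ℕ) (s>0 : ∀ j → 0 ℕ.< s j) →
    lectureHall s s>0 ≐ convexHull (λ i → ι (vertex s i))
  lectureHall≐convexHull s s>0 =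
    (λ {x} x∈LH → gaps 0# (ratio s s>0 x) , gaps-nonneg (lectureHall⇒chain s s>0 x x∈LH)
      , trans (sym (+-identityˡ _)) (sum-gaps 0# (ratio s s>0 x))
      , λ j → sym (begin
          sum (λ i → gaps 0# (ratio s s>0 x) i * ι (vertex s i) j)
            ≈⟨ vertex-combination₀ s (gaps 0# (ratio s s>0 x)) j ⟩
          partialSums 0# (gaps 0# (ratio s s>0 x)) j * fromℕ (s j)
            ≈⟨ *-congʳ (partialSums-gaps 0# (ratio s s>0 x) j) ⟩
          ratio s s>0 x j * fromℕ (s j)
            ≈⟨ */-cancel (x j) (s j) (s>0 j) ⟩
          x j ∎)) ,
    λ {x} (μ , μ≥0 , ∑μ≈1 , x≈∑) → chain⇒lectureHall s s>0 x (chain-resp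
      {r = partialSums 0# μ} refl
      (λ j → *-cancelʳ-fromℕ (s>0 j) (begin
        partialSums 0# μ j * fromℕ (s j)          ≈⟨ vertex-combination₀ s μ j ⟨
        sum (λ i → μ i * ι (vertex s i) j)        ≈⟨ x≈∑ j ⟨
        x j                                       ≈⟨ */-cancel (x j) (s j) (s>0 j) ⟨
        ratio s s>0 x j * fromℕ (s j) ∎))
      (partialSums-chain μ μ≥0 (trans (+-identityˡ _) ∑μ≈1)))

  vertices-affinelyIndependent : (s : Fin d → ℕ) → (∀ j → 0 ℕ.< s j) →
    AffinelyIndependent (λ i → ι (vertex s i))
  vertices-affinelyIndependent s s>0 μ ∑μ≈0 ∑μv≈0 =
    partialSums≈0⇒≈0 μ refl (trans (+-identityˡ _) ∑μ≈0) λ j →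
      *-cancelʳ-fromℕ (s>0 j) (begin
        partialSums 0# μ j * fromℕ (s j)     ≈⟨ vertex-combination₀ s μ j ⟨
        sum (λ i → μ i * ι (vertex s i) j)   ≈⟨ ∑μv≈0 j ⟩
        0#                                   ≈⟨ zeroˡ (fromℕ (s j)) ⟨
        0# * fromℕ (s j) ∎)

  vertex∈convexHull : (v : Vector (Point d) n) → ∀ i → v i ∈ convexHull v
  vertex∈convexHull v i =
      (λ k → fromℤ (identityMatrix i k))
    , nonneg i
    , trans (sum-cong {g = λ k → fromℤ (identityMatrix i k) * 1#} λ k → sym (*-identityʳ _))
        (select (λ _ → 1#))
    , λ j → sym (select (λ k → v k j))
    where
    nonneg : ∀ {n} (i k : Fin n) → 0# ≤ fromℤ (identityMatrix i k)
    nonneg zero    zero    = 0≤fromℕ 1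
    nonneg zero    (suc k) = ≤-reflexive refl
    nonneg (suc i) zero    = ≤-reflexive refl
    nonneg (suc i) (suc k) = nonneg i k
    select : (w : Vector Carrier _) → sum (λ k → fromℤ (identityMatrix i k) * w k) ≈ w i
    select w = ℝMatrix.mul-identityˡ
      ( (λ i → trans (reflexive (cong fromℤ (proj₁ identityMatrix-identity i))) fromℤ-1)
      , (λ i j i≢j → reflexive (cong fromℤ (proj₂ identityMatrix-identity i j i≢j))) ) w i

  isFullLatticePolytope-≐ : {P : Pred (Point d) p} {Q : Pred (Point d) q} → P ≐ Q →
    IsFullLatticePolytope P → IsFullLatticePolytope Q
  isFullLatticePolytope-≐ (P⊆Q , Q⊆P) ((n , v , P⊆hull , hull⊆P) , (w , w∈P , independent)) =
    (n , v , P⊆hull ∘ Q⊆P , P⊆Q ∘ hull⊆P) , (w , P⊆Q ∘ w∈P , independent)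

  lectureHall-isFullLatticePolytope : (s : Fin d → ℕ) (s>0 : ∀ j → 0 ℕ.< s j) →
    IsFullLatticePolytope (lectureHall s s>0)
  lectureHall-isFullLatticePolytope s s>0 =
    (_ , vertex s , lectureHall≐convexHull s s>0) ,
    ((λ i → ι (vertex s i)) ,
     (λ i → proj₂ (lectureHall≐convexHull s s>0) (vertex∈convexHull (λ i → ι (vertex s i)) i)) ,
     vertices-affinelyIndependent s s>0)

  dilate-lectureHall : ∀ {k} → 0 ℕ.< k →
    {s t : Fin d → ℕ} {s>0 : ∀ j → 0 ℕ.< s j} {t>0 : ∀ j → 0 ℕ.< t j} → (∀ j → t j ≡ k ℕ.* s j) →
    dilate k (lectureHall s s>0) ≐ lectureHall t t>0
  dilate-lectureHall {k = k} k>0 {s} {t} {s>0} {t>0} t≡ks =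
    (λ {x} (α , α∈LH , x≈kα) → lectureHall-ratio s t s>0 t>0 α x
      (λ j → same-ratio (x≈kα j)) α∈LH) ,
    λ {x} x∈LH → let α = λ j → x j * 1/ k k>0
                     x≈kα = λ j → sym (trans (*-comm (fromℕ k) (α j)) (*/-cancel (x j) k k>0))
                 in α , lectureHall-ratio t s t>0 s>0 x α
                          (λ j → sym (same-ratio (x≈kα j))) x∈LH , x≈kα
    where
    same-ratio : ∀ {j a x} → x ≈ fromℕ k * a → a * 1/ (s j) (s>0 j) ≈ x * 1/ (t j) (t>0 j)
    same-ratio {j} {a} {x} x≈ka = *-cancelʳ-fromℕ (t>0 j) (begin
      a * 1/ (s j) (s>0 j) * fromℕ (t j)
        ≈⟨ *-congˡ (trans (reflexive (cong fromℕ (t≡ks j))) (fromℕ-* k (s j))) ⟩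
      a * 1/ (s j) (s>0 j) * (fromℕ k * fromℕ (s j))
        ≈⟨ solve 4 (λ a u k s → a :* u :* (k :* s) := k :* (a :* u :* s)) refl
             a (1/ (s j) (s>0 j)) (fromℕ k) (fromℕ (s j)) ⟩
      fromℕ k * (a * 1/ (s j) (s>0 j) * fromℕ (s j))
        ≈⟨ *-congˡ (*/-cancel a (s j) (s>0 j)) ⟩
      fromℕ k * a
        ≈⟨ x≈ka ⟨
      x
        ≈⟨ */-cancel x (t j) (t>0 j) ⟨
      x * 1/ (t j) (t>0 j) * fromℕ (t j) ∎)

-- Comparison of the two conditions.

module Gorenstein {c ℓ₁ ℓ₂} (ℝ : RealField c ℓ₁ ℓ₂) where
  open RealField ℝ hiding (zero)
  open Polytopes ℝ
  open LatticePolytopes ℝ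
  open LectureHall ℝ
  open Determinant

  private
    variable
      d : ℕ
      p q : Level

  -- The reflexive polytope in `IsGorenstein` is an arbitrary predicate; agreeing with a convex hull
  -- is what makes it compatible with `_≈ᵥ_`.
  latticePolytope-resp : {P : Pred (Point d) p} → IsLatticePolytope P → P Respects _≈ᵥ_
  latticePolytope-resp (n , v , P⊆hull , hull⊆P) x≈y x∈P =
    hull⊆P (convexHull-resp (λ i → ι (v i)) x≈y (P⊆hull x∈P))

  linearMap-translate : (U : Matrix d) {x α : Point d} {w : Vector ℤ d} →
    (x ≈ᵥ λ j → α j + ι w j) →
    linearMap U x ≈ᵥ λ j → linearMap U α j + ι (linearMapℤ U w) j
  linearMap-translate U {x} {α} {w} x≈α+w j = trans (linearMap-cong U x≈α+w j)
    (trans (linearMap-+ U α (ι w) j) (+-congˡ (linearMap-ι U w j)))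

  -- Applying `V` to `Q = PU + w` gives `QV = P + wV`, which is where the translation vector comes
  -- from.
  undo-unimodular : {P : Pred (Point d) p} {Q : Pred (Point d) q}
    {U V : Matrix d} {w : Vector ℤ d} →
    IsLatticePolytope Q → Inverses U V → Q ≐ translate w (image (linearMap U) P) →
    IntegrallyEquivalent Q (translate (linearMapℤ V w) P) V U
  undo-unimodular {P = P} {Q} {U} {V} {w} lattice (UV , VU) (Q⊆ , ⊆Q) = record
    { inverses = VU , UV
    ; respˡ = latticePolytope-resp lattice
    ; respʳ = λ x≈y (α , α∈P , x≈α+w) → α , α∈P , λ j → trans (sym (x≈y j)) (x≈α+w j)
    ; to = λ {y} y∈Q → let α , (β , β∈P , α≈βU) , y≈α+w = Q⊆ y∈Q in
        β , β∈P , λ j → trans (linearMap-translate V {w = w} y≈α+w j)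
          (+-congʳ (trans (linearMap-cong V α≈βU j) (linearMap-inverse U V UV β j)))
    ; from = λ {x} (β , β∈P , x≈β+w′) → ⊆Q (linearMap U β , (β , β∈P , λ j → refl) ,
        λ j → trans (linearMap-translate U {w = linearMapℤ V w} x≈β+w′ j)
          (+-congˡ (reflexive (cong fromℤ (linearMapℤ-inverse V U VU w j)))))
    }

  translate-≐ : {P : Pred (Point d) p} {Q : Pred (Point d) q} (w : Vector ℤ d) → P ≐ Q →
    translate w P ≐ translate w Q
  translate-≐ w (P⊆Q , Q⊆P) =
    (λ (α , α∈P , x≈) → α , P⊆Q α∈P , x≈) , (λ (α , α∈Q , x≈) → α , Q⊆P α∈Q , x≈)

  image-≐ : {P : Pred (Point d) p} {Q : Pred (Point d) q} (f : Point d → Point d) → P ≐ Q →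
    image f P ≐ image f Q
  image-≐ f (P⊆Q , Q⊆P) =
    (λ (α , α∈P , x≈) → α , P⊆Q α∈P , x≈) , (λ (α , α∈Q , x≈) → α , Q⊆P α∈Q , x≈)

  image-identity : {P : Pred (Point d) p} → P Respects _≈ᵥ_ →
    P ≐ image (linearMap identityMatrix) P
  image-identity resp =
    (λ {x} x∈P → x , x∈P ,
      λ j → sym (linearMap-identity identityMatrix identityMatrix-identity x j)) ,
    λ (α , α∈P , x≈α) → resp (λ j → sym (trans (x≈α j)
      (linearMap-identity identityMatrix identityMatrix-identity α j))) α∈P

  -- Keeping `t` abstract, with a pointwise equation, serves both the constructed sequence and a
  -- given one with its own positivity proof.
  gorenstein⇔dilation-reflexive : ∀ {k} → 0 ℕ.< k → {s t : Fin d → ℕ}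
    {s>0 : ∀ j → 0 ℕ.< s j} {t>0 : ∀ j → 0 ℕ.< t j} → (∀ j → t j ≡ k ℕ.* s j) →
    IsGorenstein k (lectureHall s s>0) ⇔ IsReflexiveUpToTranslation (lectureHall t t>0)
  gorenstein⇔dilation-reflexive {d = d} {k} k>0 {s} {t} {s>0} {t>0} t≡ks = mk⇔ ⇒ ⇐
    where
    kP≐Pₜ : dilate k (lectureHall s s>0) ≐ lectureHall t t>0
    kP≐Pₜ = dilate-lectureHall k>0 t≡ks
    ⇒ : IsGorenstein k (lectureHall s s>0) → IsReflexiveUpToTranslation (lectureHall t t>0)
    ⇒ (_ , _ , Q , Q-reflexive , _ , ((Q-lattice , _) , U , detU≡±1 , w , Q≐)) =
      let V , UV = unimodular⇒inverse U detU≡±1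
      in linearMapℤ V w , isReflexive
           (undo-unimodular {P = lectureHall t t>0} {Q} {U} {V} {w} Q-lattice UV
             (≐-trans Q≐ (translate-≐ w (image-≐ (linearMap U) kP≐Pₜ))))
           Q-reflexive
    ⇐ : IsReflexiveUpToTranslation (lectureHall t t>0) → IsGorenstein k (lectureHall s s>0)
    ⇐ (w , reflexive′@((full , _) , _)) =
      -- The reflexive translate itself is taken as `Q`; the equivalence is translation by `w` after
      -- the identity matrix.
      k>0 , lectureHall-isFullLatticePolytope s s>0 , translate w (lectureHall t t>0) , reflexive′ ,
      isFullLatticePolytope-≐ (≐-sym kP≐Pₜ) (lectureHall-isFullLatticePolytope t t>0) , full ,
      identityMatrix , inj₁ (det-identity (identityMatrix {d}) (identityMatrix-identity {d})) , w ,
      translate-≐ w (≐-trans (image-identity (lectureHall-resp t t>0))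
        (image-≐ (linearMap identityMatrix) (≐-sym kP≐Pₜ)))

open import Data.Nat using (_*_; _≤_; _<_)

corollary2p7 :
  ∀ {c ℓ₁ ℓ₂} (ℝ : RealField c ℓ₁ ℓ₂) →
  let open Polytopes ℝ in
  ∀ (d : ℕ) → 1 ≤ d →
  ∀ (s : Fin d → ℕ) (s>0 : ∀ j → 0 < s j) →
  -- i is the zero-based position of the last entry equal to the first one
  ∀ (i : Fin d) →
  (∀ j → toℕ j ≤ toℕ i → s j ≡ s i) →
  (∀ j j′ → toℕ i ≤ toℕ j → toℕ j′ ≡ suc (toℕ j) → s j < s j′) →
  ∀ (k : ℕ) → 0 < k →
  IsGorenstein k (lectureHall s s>0)
    ⇔ (Σ (Fin d → ℕ) λ t → Σ (∀ j → 0 < t j) λ t>0 →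
         (∀ j → t j ≡ k * s j) × IsReflexiveUpToTranslation (lectureHall t t>0))
corollary2p7 ℝ d _ s s>0 _ _ _ k k>0 = mk⇔
  (λ gorenstein → ks , ks>0 , (λ j → ≡.refl) ,
    Equivalence.to (gorenstein⇔dilation-reflexive k>0 λ j → ≡.refl) gorenstein)
  (λ (t , t>0 , t≡ks , reflexive) →
    Equivalence.from (gorenstein⇔dilation-reflexive k>0 t≡ks) reflexive)
  where
  open Gorenstein ℝ
  ks : Fin d → ℕ
  ks j = k * s j
  ks>0 : ∀ j → 0 < ks j
  ks>0 j = ℕ.*-mono-< k>0 (s>0 j)
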